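{- Let $\pi=(d_1,\dots,d_n)$ be a graphic sequence with $d_1\ge d_2\ge\cdots\ge d_n$. Then there exists a simple graph $G$ with vertex set $V(G)=\{v_1,\dots,v_n\}$ and $d_G(v_i)=d_i$ for all $i\in[n]$ such that, if $H$ denotes the parity bisection of $G$ (with respect to this labeling), then $d_H(v_i)\ge (d_G(v_i)-1)/2$ for all $i\in[n]$.
   Context: A sequence of nonnegative integers is graphic if it is the degree sequence of some finite simple graph. $[k]=\{1,\dots,k\}$. For a graph $G$ with vertices labeled $V(G)=\{v_1,\dots,v_n\}$, the parity bisection of $G$ is the spanning bipartite subgraph $H$ with partition sets $V_1=\{v_j: j \text{ odd}\}$ and $V_2=\{v_j: j\text{ even}\}$ and edge set $E(H)=\{uv\in E(G): u\in V_1, v\in V_2\}$. $d_G(v)$ denotes the degree of $v$ in $G$. -}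

module Defs where

open import Data.Fin.Base using (Fin; toℕ; _≤_)
open import Data.Nat.Base as ℕ using (ℕ; suc; parity)
open import Data.Parity.Base using (0ℙ; 1ℙ)
open import Data.Parity.Properties using () renaming (_≟_ to _≟ℙ_)
open import Data.Product.Base using (_×_; _,_; ∃-syntax)
open import Data.Sum.Base as Sum using (_⊎_)
open import Data.Vec.Base using (allFin; count)
open import Data.Vec.Functional using (Vector)
open import Level using (0ℓ)
open import Relation.Binary.Core using (Rel)
open import Relation.Binary.Definitions using (Decidable; Symmetric; Irreflexive)
open import Relation.Binary.PropositionalEquality using (_≡_)
open import Relation.Nullary.Decidable using (_×-dec_; _⊎-dec_)
import Data.Product.Base as Product
import Relation.Unary as U

-- Vertex v_j (1 ≤ j ≤ n) is the element of Fin n with toℕ value j − 1.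
-- Adjacency is decidable so that neighbours can be counted.
record SimpleGraph (n : ℕ) : Set₁ where
  field
    Adj    : Rel (Fin n) 0ℓ
    adj?   : Decidable Adj
    sym    : Symmetric Adj
    irrefl : Irreflexive _≡_ Adj

  degree : Fin n → ℕ
  degree v = count (adj? v) (allFin n)

open SimpleGraph public using (degree)

-- d is the degree sequence of G under the given labelling of its vertices.
HasDegrees : ∀ {n} → SimpleGraph n → Vector ℕ n → Set
HasDegrees G d = ∀ i → degree G i ≡ d i

Graphic : ∀ {n} → Vector ℕ n → Set₁
Graphic {n} d = ∃[ G ] HasDegrees {n} G d

Nonincreasing : ∀ {n} → Vector ℕ n → Set
Nonincreasing d = ∀ i j → i ≤ j → d j ℕ.≤ d i

label : ∀ {n} → Fin n → ℕ
label v = suc (toℕ v)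

V₁ V₂ : ∀ {n} → U.Pred (Fin n) 0ℓ
V₁ v = parity (label v) ≡ 1ℙ
V₂ v = parity (label v) ≡ 0ℙ

V₁? : ∀ {n} → U.Decidable (V₁ {n})
V₁? v = parity (label v) ≟ℙ 1ℙ

V₂? : ∀ {n} → U.Decidable (V₂ {n})
V₂? v = parity (label v) ≟ℙ 0ℙ

-- Edges are unordered, so "u ∈ V₁ and v ∈ V₂" is taken in both orders.
parityBisection : ∀ {n} → SimpleGraph n → SimpleGraph n
parityBisection G = record
  { Adj    = λ u v → Adj u v × ((V₁ u × V₂ v) ⊎ (V₁ v × V₂ u))
  ; adj?   = λ u v → adj? u v ×-dec ((V₁? u ×-dec V₂? v) ⊎-dec (V₁? v ×-dec V₂? u))
  ; sym    = Product.map sym Sum.swap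
  ; irrefl = λ { u≡v (uv , _) → irrefl u≡v uv }
  }
  where open SimpleGraph G

{-# OPTIONS --safe #-}
module Submission where

-- Some two vertices of a graph have equal degree, and by monotonicity two consecutive ones u, w do;
-- they lie in different classes, and deleting them keeps the classes alternating.  Edges from
-- {u, w} to the rest are first moved, by switchings, towards rest-vertices that keep a high degree.
-- At the end the remaining degrees are again nonincreasing, and there is a level E such that the
-- vertices of degree above E are joined to both u and w, those of degree E to one or both, those of
-- degree E - 1 to none or one, and the others to none; so by induction the rest has a realization
-- with the required property.  Finally u and w are put back: vertices with two edges into {u, w} are
-- unaffected, and those with one edge are given their neighbour in the opposite class.  The sets of
-- vertices with one and with two edges are differences of initial segments, in which the odd class
-- outnumbers the even one by 0 or 1; this bounds all imbalances.  If u and w would then have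
-- different degrees, the vertices with a single edge include some of degree E and some of degree
-- E - 1 in the larger class, and it suffices to give one of odd degree its neighbour in its own class.

open import Defs
open import Data.Bool.Base using (Bool; true; false; if_then_else_; not; _∧_; _∨_; _xor_)
open import Data.Bool.Properties as Bool using (∧-comm; ∨-comm; ∧-zeroʳ; ∨-zeroʳ; not-involutive)
open import Data.Fin.Base using (Fin; zero; suc; toℕ; inject₁; fromℕ; punchIn)
open import Data.Fin.Properties as Fin using (_≟_; any?; toℕ<n)
import Data.Integer.Properties as ℤ
open import Data.Nat.Base as ℕ using (ℕ; zero; suc; _+_; _*_; _∸_; _≤_; _<_; z≤n; s≤s)
open import Data.Nat.Induction using (Acc; acc; <-wellFounded)
open import Data.Nat.Properties renaming (_≟_ to _ℕ-≟_)
open import Data.Nat.Tactic.RingSolver using (solve-∀)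
open import Data.Parity.Base using (0ℙ; 1ℙ; _⁻¹)
import Data.Parity.Properties as ℙ
open import Data.Product.Base using (_×_; _,_; ∃-syntax; proj₁; proj₂)
open import Data.Rational.Unnormalised.Base using (_/_; _≥_; *≤*)
open import Data.Sum.Base using (_⊎_; inj₁; inj₂; map₂)
import Data.Vec.Base as Vec
open import Data.Vec.Functional using (Vector)
open import Function.Base using (id; _∘_; _$_)
open import Function.Bundles using (mk⇔)
open import Relation.Binary.PropositionalEquality hiding (J)
open import Relation.Nullary using (¬_; Dec; yes; no; does; proof; contradiction; Reflects; ofʸ; ofⁿ)
open import Relation.Nullary.Decidable using (dec-true; dec-false; does-⇔; _×-dec_; _⊎-dec_)
open import Relation.Nullary.Reflects using (det)
open import Algebra.Properties.Semiring.Sum +-*-semiring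
  using (sum; sum-cong-≗; ∑-distrib-+; *-distribˡ-sum; sum-replicate-zero; sum-remove)

private variable
  n : ℕ

-- Counting with Boolean indicators and finite sums.

χ : Bool → ℕ
χ false = 0
χ true  = 1

χ≤1 : ∀ b → χ b ≤ 1
χ≤1 false = z≤n
χ≤1 true  = ≤-refl

count : (Fin n → Bool) → ℕ
count P = sum (χ ∘ P)

[_≐_] : Fin n → Fin n → ℕ
[ i ≐ j ] = χ (does (i ≟ j))

≐-refl : ∀ (i : Fin n) → [ i ≐ i ] ≡ 1
≐-refl i = cong χ (dec-true (i ≟ i) refl)

≐-≢ : ∀ {i j : Fin n} → i ≢ j → [ i ≐ j ] ≡ 0
≐-≢ {i = i} {j} i≢j = cong χ (dec-false (i ≟ j) i≢j)

sum-mono-≤ : ∀ {f g : Fin n → ℕ} → (∀ i → f i ≤ g i) → sum f ≤ sum g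
sum-mono-≤ {zero}  f≤g = z≤n
sum-mono-≤ {suc n} f≤g = +-mono-≤ (f≤g zero) (sum-mono-≤ (f≤g ∘ suc))

lookup≤sum : ∀ (f : Fin n → ℕ) i → f i ≤ sum f
lookup≤sum f zero    = m≤m+n _ _
lookup≤sum f (suc i) = ≤-trans (lookup≤sum (f ∘ suc) i) (m≤n+m _ (f zero))

sum-const-1 : ∀ n → sum {n} (λ _ → 1) ≡ n
sum-const-1 zero    = refl
sum-const-1 (suc n) = cong suc (sum-const-1 n)

sum-≐ : ∀ (i : Fin n) (f : Fin n → ℕ) → sum (λ j → [ i ≐ j ] * f j) ≡ f i
sum-≐ {suc n} zero f = trans (cong₂ _+_ (*-identityˡ (f zero)) (sum-replicate-zero n)) (+-identityʳ (f zero))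
sum-≐ (suc i) f = sum-≐ i (f ∘ suc)

sum-[≐] : ∀ (i : Fin n) → sum (λ j → [ i ≐ j ]) ≡ 1
sum-[≐] i = trans (sum-cong-≗ λ j → sym (*-identityʳ [ i ≐ j ])) (sum-≐ i (λ _ → 1))

sum-<⇒∃ : ∀ (f g : Fin n → ℕ) → sum f < sum g → ∃[ i ] f i < g i
sum-<⇒∃ f g Σf<Σg with any? (λ i → f i <? g i)
... | yes p = p
... | no ¬p = contradiction Σf<Σg (≤⇒≯ (sum-mono-≤ (λ i → ≮⇒≥ (λ fi<gi → ¬p (i , fi<gi)))))

count>0⇒∃ : ∀ (P : Fin n → Bool) → 1 ≤ count P → ∃[ i ] P i ≡ true
count>0⇒∃ {suc n} P 1≤ with P zero in eq
... | true  = zero , eq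
... | false = let i , Pi = count>0⇒∃ (P ∘ suc) 1≤ in suc i , Pi

sum-+₂ : ∀ (f g h : Fin n → ℕ) → sum (λ i → f i + (g i + h i)) ≡ sum f + (sum g + sum h)
sum-+₂ f g h = trans (∑-distrib-+ f _) (cong (sum f +_) (∑-distrib-+ g h))

sum-+-≡ : ∀ (f g h k : Fin n → ℕ) → (∀ i → f i + g i ≡ h i + k i) →
          sum f + sum g ≡ sum h + sum k
sum-+-≡ f g h k eq = trans (sym (∑-distrib-+ f g)) (trans (sum-cong-≗ eq) (∑-distrib-+ h k))

-- Adding to each function the values of the other at `a` and `b` gives pointwise equal functions,
-- so the sums compare as the values at `a` and `b` do.
sum-<-replace₂ : ∀ (f g : Fin n → ℕ) {a b} → a ≢ b →
                 (∀ i → i ≢ a → i ≢ b → f i ≡ g i) →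
                 f a + f b < g a + g b → sum f < sum g
sum-<-replace₂ f g {a} {b} a≢b f≡g fab<gab =
  +-cancelʳ-< (g a + g b) (sum f) (sum g) $ begin-strict
    sum f + (g a + g b)  ≡⟨ total f g ⟨
    sum (λ i → f i + ([ a ≐ i ] * g i + [ b ≐ i ] * g i))  ≡⟨ sum-cong-≗ pointwise ⟩
    sum (λ i → g i + ([ a ≐ i ] * f i + [ b ≐ i ] * f i))  ≡⟨ total g f ⟩
    sum g + (f a + f b)  <⟨ +-monoʳ-< (sum g) fab<gab ⟩
    sum g + (g a + g b)  ∎
  where
  open ≤-Reasoning
  total : ∀ h k → sum (λ i → h i + ([ a ≐ i ] * k i + [ b ≐ i ] * k i)) ≡ sum h + (k a + k b)
  total h k = trans (sum-+₂ h _ _) (cong (sum h +_) (cong₂ _+_ (sum-≐ a k) (sum-≐ b k)))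
  swap : ∀ x y → x + (1 * y + 0) ≡ y + (1 * x + 0)
  swap = solve-∀
  swap′ : ∀ x y → x + (0 + 1 * y) ≡ y + (0 + 1 * x)
  swap′ = solve-∀
  pointwise : ∀ i → f i + ([ a ≐ i ] * g i + [ b ≐ i ] * g i) ≡ g i + ([ a ≐ i ] * f i + [ b ≐ i ] * f i)
  pointwise i with a ≟ i | b ≟ i
  ... | yes refl | yes refl = contradiction refl a≢b
  ... | yes refl | no  _    = swap (f i) (g i)
  ... | no  _    | yes refl = swap′ (f i) (g i)
  ... | no a≢i   | no b≢i   = cong (_+ 0) (f≡g i (a≢i ∘ sym) (b≢i ∘ sym))

-- Boolean graphs and the switching of an edge.

record Graph (n : ℕ) : Set where
  field
    adj        : Fin n → Fin n → Bool
    adj-sym    : ∀ i j → adj i j ≡ adj j i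
    adj-irrefl : ∀ i → adj i i ≡ false

open Graph

deg : Graph n → Fin n → ℕ
deg G i = count (adj G i)

pair : Fin n → Fin n → Fin n → Fin n → Bool
pair x y i j = (does (x ≟ i) ∧ does (y ≟ j)) ∨ (does (y ≟ i) ∧ does (x ≟ j))

pair-sym : ∀ (x y i j : Fin n) → pair x y i j ≡ pair x y j i
pair-sym x y i j = trans (∨-comm (does (x ≟ i) ∧ does (y ≟ j)) _)
  (cong₂ _∨_ (∧-comm (does (y ≟ i)) _) (∧-comm (does (x ≟ i)) _))

pair-irrefl : ∀ {x y : Fin n} → x ≢ y → ∀ i → pair x y i i ≡ false
pair-irrefl {x = x} {y} x≢y i with x ≟ i | y ≟ i
... | yes refl | yes refl = contradiction refl x≢y
... | yes _    | no _     = refl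
... | no _     | yes _    = refl
... | no _     | no _     = refl

pair-true : ∀ (x y i j : Fin n) → pair x y i j ≡ true → (x ≡ i × y ≡ j) ⊎ (y ≡ i × x ≡ j)
pair-true x y i j eq with x ≟ i | y ≟ j | y ≟ i | x ≟ j
... | yes p | yes q | _     | _     = inj₁ (p , q)
... | no _  | _     | yes p | yes q = inj₂ (p , q)
... | yes _ | no _  | yes p | yes q = inj₂ (p , q)
pair-true x y i j () | yes _ | no _ | yes _ | no _
pair-true x y i j () | yes _ | no _ | no _ | _
pair-true x y i j () | no _ | _ | yes _ | no _
pair-true x y i j () | no _ | _ | no _ | _

count-pair : ∀ {x y : Fin n} → x ≢ y → ∀ i → count (pair x y i) ≡ [ x ≐ i ] + [ y ≐ i ]
count-pair {x = x} {y} x≢y i = trans (sum-cong-≗ pointwise)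
  (trans (∑-distrib-+ (λ j → [ x ≐ i ] * [ y ≐ j ]) _)
    (cong₂ _+_ (scaled [ x ≐ i ] y) (scaled [ y ≐ i ] x)))
  where
  scaled : ∀ m z → sum (λ j → m * [ z ≐ j ]) ≡ m
  scaled m z = trans (sym (*-distribˡ-sum m (λ j → [ z ≐ j ])))
    (trans (cong (m *_) (sum-[≐] z)) (*-identityʳ m))
  pointwise : ∀ j → χ (pair x y i j) ≡ [ x ≐ i ] * [ y ≐ j ] + [ y ≐ i ] * [ x ≐ j ]
  pointwise j with x ≟ i | y ≟ i
  ... | yes refl | yes refl = contradiction refl x≢y
  ... | no _     | no _     = refl
  ... | no _     | yes _    = sym (+-identityʳ _)
  ... | yes _    | no _     with does (y ≟ j)
  ...   | true  = refl
  ...   | false = refl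

-- `O` is removed from `A` and `N` added. As `O` lies inside `A` and `N` outside, they are disjoint
-- and both changes count in full.
χ-exchange : ∀ A O N → (O ≡ true → A ≡ true) → (N ≡ true → A ≡ false) →
             χ ((A ∨ N) ∧ not O) + χ O ≡ χ A + χ N
χ-exchange false false false _  _  = refl
χ-exchange false false true  _  _  = refl
χ-exchange false true  _     O⇒ _  = contradiction (O⇒ refl) λ ()
χ-exchange true  false false _  _  = refl
χ-exchange true  _     true  _  N⇒ = contradiction (N⇒ refl) λ ()
χ-exchange true  true  false _  _  = refl

-- Replacing the edge zb by the edge za.
shift : ∀ (G : Graph n) {z a b} → z ≢ a → adj G z b ≡ true → adj G z a ≡ false →
        ∃[ G′ ] (∀ i → deg G′ i + [ b ≐ i ] ≡ deg G i + [ a ≐ i ])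
shift {n} G {z} {a} {b} z≢a zb za = G′ , degrees
  where
  z≢b : z ≢ b
  z≢b refl = contradiction (trans (sym zb) (adj-irrefl G z)) λ ()
  G′ : Graph n
  G′ .adj i j = (adj G i j ∨ pair z a i j) ∧ not (pair z b i j)
  G′ .adj-sym i j = cong₂ (λ p q → p ∧ not q)
    (cong₂ _∨_ (adj-sym G i j) (pair-sym z a i j)) (pair-sym z b i j)
  G′ .adj-irrefl i rewrite adj-irrefl G i | pair-irrefl z≢a i = refl
  old : ∀ i j → pair z b i j ≡ true → adj G i j ≡ true
  old i j p with pair-true z b i j p
  ... | inj₁ (refl , refl) = zb
  ... | inj₂ (refl , refl) = trans (adj-sym G b z) zb
  new : ∀ i j → pair z a i j ≡ true → adj G i j ≡ false
  new i j p with pair-true z a i j p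
  ... | inj₁ (refl , refl) = za
  ... | inj₂ (refl , refl) = trans (adj-sym G a z) za
  row : ∀ i → deg G′ i + count (pair z b i) ≡ deg G i + count (pair z a i)
  row i = sum-+-≡ (χ ∘ adj G′ i) (χ ∘ pair z b i) (χ ∘ adj G i) (χ ∘ pair z a i)
    λ j → χ-exchange (adj G i j) _ _ (old i j) (new i j)
  swap : ∀ x y w → x + (y + w) ≡ y + (x + w)
  swap = solve-∀
  degrees : ∀ i → deg G′ i + [ b ≐ i ] ≡ deg G i + [ a ≐ i ]
  degrees i = +-cancelˡ-≡ [ z ≐ i ] _ _ $ begin
    [ z ≐ i ] + (deg G′ i + [ b ≐ i ])   ≡⟨ swap [ z ≐ i ] (deg G′ i) _ ⟩
    deg G′ i + ([ z ≐ i ] + [ b ≐ i ])   ≡⟨ cong (deg G′ i +_) (count-pair z≢b i) ⟨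
    deg G′ i + count (pair z b i)        ≡⟨ row i ⟩
    deg G i + count (pair z a i)         ≡⟨ cong (deg G i +_) (count-pair z≢a i) ⟩
    deg G i + ([ z ≐ i ] + [ a ≐ i ])    ≡⟨ swap (deg G i) [ z ≐ i ] _ ⟩
    [ z ≐ i ] + (deg G i + [ a ≐ i ])    ∎
    where open ≡-Reasoning

-- Supplies the edge for a switching that raises the degree of `a` at the cost of `b`. A possible
-- edge `ab` counts once for each end, so the surplus of `b` lies outside `{a, b}`.
private-neighbour : ∀ (G : Graph n) {a b} → deg G a < deg G b →
  ∃[ z ] (z ≢ a × adj G z b ≡ true × adj G z a ≡ false)
private-neighbour {n} G {a} {b} da<db = z , z≢a , proj₁ χ<χ , proj₂ χ<χ
  where
  a≢b : a ≢ b
  a≢b refl = <-irrefl refl da<db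
  -- The possible edge ab is compensated on both sides, so that neither a nor b can be z.
  f g : Fin n → ℕ
  f i = χ (adj G a i) + [ a ≐ i ] * χ (adj G b i)
  g i = χ (adj G b i) + [ b ≐ i ] * χ (adj G a i)
  Σf : sum f ≡ deg G a + χ (adj G b a)
  Σf = trans (∑-distrib-+ (χ ∘ adj G a) _) (cong (deg G a +_) (sum-≐ a (χ ∘ adj G b)))
  Σg : sum g ≡ deg G b + χ (adj G a b)
  Σg = trans (∑-distrib-+ (χ ∘ adj G b) _) (cong (deg G b +_) (sum-≐ b (χ ∘ adj G a)))
  Σf<Σg : sum f < sum g
  Σf<Σg = subst₂ _<_ (sym Σf) (sym (trans Σg (cong (λ e → deg G b + χ e) (adj-sym G a b))))
    (+-monoˡ-< (χ (adj G b a)) da<db)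
  witness = sum-<⇒∃ f g Σf<Σg
  z = proj₁ witness
  z≢a : z ≢ a
  z≢a z≡a = <-irrefl eq (proj₂ witness)
    where
    eq : f z ≡ g z
    eq rewrite z≡a | adj-irrefl G a | ≐-refl a | ≐-≢ (a≢b ∘ sym) = refl
  z≢b : z ≢ b
  z≢b z≡b = <-irrefl eq (proj₂ witness)
    where
    eq : f z ≡ g z
    eq rewrite z≡b | adj-irrefl G b | ≐-refl b | ≐-≢ a≢b = refl
  χ<χ : adj G z b ≡ true × adj G z a ≡ false
  χ<χ with lt ← proj₂ witness
    rewrite ≐-≢ (z≢a ∘ sym) | ≐-≢ (z≢b ∘ sym) | adj-sym G z b | adj-sym G z a
    with adj G a z | adj G b z
  ... | false | true  = refl , refl
  ... | true  | true  = contradiction lt λ { (s≤s ()) }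

-- Levelling the remaining degrees by switchings.

Fits : (Fin n → ℕ) → Graph n → Set
Fits δ G = ∀ i → deg G i ≤ δ i × δ i ≤ 2 + deg G i

-- `δ` is the degree in the whole graph and `f` the degree within the rest, so `δ - f` edges go to
-- the deleted pair. The switching passes one of them from `a` to `b`, which has at most one. If
-- `f b` exceeds `f a` by exactly 1, the two values are merely exchanged, which is progress only
-- when `a` comes first.
Improvable : (δ f : Fin n → ℕ) → Fin n → Fin n → Set
Improvable δ f a b =
  f a < δ a × δ b ≤ suc (f b) × f a < f b × (toℕ a < toℕ b ⊎ suc (f a) < f b)

improvable? : ∀ (δ f : Fin n → ℕ) a b → Dec (Improvable δ f a b)
improvable? δ f a b =
  f a <? δ a ×-dec δ b ≤? suc (f b) ×-dec f a <? f b ×-dec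
  (toℕ a <? toℕ b ⊎-dec suc (f a) <? f b)

-- The squares dominate; the linear term breaks ties in favour of the index order.
Φ : (Fin n → ℕ) → ℕ
Φ {n} f = sum (λ i → f i * (n * f i + toℕ i))

-- `B` is the degree of `b` after the step. The term at `a` grows by `n * (1 + 2 * A) + x`, the one
-- at `b` shrinks by `n * (1 + 2 * B) + y`. If `A < B`, the squares alone yield `2 * n`, more than
-- `x`.
Φ-local : ∀ {n} A B x y → A ≤ B → x < n → x < y ⊎ A < B →
          suc A * (n * suc A + x) + B * (n * B + y) < A * (n * A + x) + suc B * (n * suc B + y)
Φ-local {n} A B x y A≤B x<n x<y⊎A<B = subst₂ _<_ (lhs n A B x y) (rhs n A B x y)
  (+-monoʳ-< (A * (n * A + x) + B * (n * B + y)) (key x<y⊎A<B))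
  where
  lhs : ∀ n A B x y → A * (n * A + x) + B * (n * B + y) + (n * (1 + 2 * A) + x) ≡
                      suc A * (n * suc A + x) + B * (n * B + y)
  lhs = solve-∀
  rhs : ∀ n A B x y → A * (n * A + x) + B * (n * B + y) + (n * (1 + 2 * B) + y) ≡
                      A * (n * A + x) + suc B * (n * suc B + y)
  rhs = solve-∀
  key : x < y ⊎ A < B → n * (1 + 2 * A) + x < n * (1 + 2 * B) + y
  key (inj₁ x<y) = +-mono-≤-< (*-monoʳ-≤ n (s≤s (*-monoʳ-≤ 2 A≤B))) x<y
  key (inj₂ A<B) = begin-strict
    n * (1 + 2 * A) + x  <⟨ +-monoʳ-< _ x<n ⟩
    n * (1 + 2 * A) + n  ≤⟨ m≤m+n _ n ⟩
    n * (1 + 2 * A) + n + n ≡⟨ step n A ⟩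
    n * (1 + 2 * suc A)  ≤⟨ *-monoʳ-≤ n (s≤s (*-monoʳ-≤ 2 A<B)) ⟩
    n * (1 + 2 * B)      ≤⟨ m≤m+n _ y ⟩
    n * (1 + 2 * B) + y  ∎
    where
    open ≤-Reasoning
    step : ∀ n A → n * (1 + 2 * A) + n + n ≡ n * (1 + 2 * suc A)
    step = solve-∀

level-step : ∀ (δ : Fin n → ℕ) G {a b} → Fits δ G → Improvable δ (deg G) a b →
  ∃[ G′ ] (Fits δ G′ × sum (deg G′) ≡ sum (deg G) × Φ (deg G′) < Φ (deg G))
level-step {n} δ G {a} {b} fits (fa<δa , δb≤ , fa<fb , a<b⊎) =
  let z , z≢a , zb , za = private-neighbour G fa<fb
      G′ , eq = shift G z≢a zb za
  in G′ , G′-facts G′ eq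
  where
  a≢b : a ≢ b
  a≢b refl = <-irrefl refl fa<fb
  G′-facts : ∀ G′ → (∀ i → deg G′ i + [ b ≐ i ] ≡ deg G i + [ a ≐ i ]) →
             Fits δ G′ × sum (deg G′) ≡ sum (deg G) × Φ (deg G′) < Φ (deg G)
  G′-facts G′ eq = fits′ , same-sum , sum-<-replace₂ _ _ a≢b unchanged decrease
    where
    at-a : deg G′ a ≡ suc (deg G a)
    at-a with e ← eq a rewrite ≐-refl a | ≐-≢ (a≢b ∘ sym) = trans (sym (+-identityʳ _)) (trans e (+-comm _ 1))
    at-b : deg G b ≡ suc (deg G′ b)
    at-b with e ← eq b rewrite ≐-refl b | ≐-≢ a≢b = sym (trans (+-comm 1 _) (trans e (+-identityʳ _)))
    off : ∀ i → i ≢ a → i ≢ b → deg G′ i ≡ deg G i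
    off i i≢a i≢b with e ← eq i rewrite ≐-≢ (i≢a ∘ sym) | ≐-≢ (i≢b ∘ sym) = +-cancelʳ-≡ 0 _ _ e
    fits′ : Fits δ G′
    fits′ i with i ≟ a | i ≟ b
    ... | yes refl | _        rewrite at-a = fa<δa , m≤n⇒m≤1+n (proj₂ (fits a))
    ... | no _     | yes refl = ≤-trans (n≤1+n _) (subst (_≤ δ b) at-b (proj₁ (fits b))) ,
                                subst (λ m → δ b ≤ suc m) at-b δb≤
    ... | no i≢a   | no i≢b   rewrite off i i≢a i≢b = fits i
    same-sum : sum (deg G′) ≡ sum (deg G)
    same-sum = +-cancelʳ-≡ 1 _ _ (begin
      sum (deg G′) + 1                     ≡⟨ cong (sum (deg G′) +_) (sum-[≐] b) ⟨
      sum (deg G′) + sum (λ i → [ b ≐ i ]) ≡⟨ sum-+-≡ (deg G′) _ (deg G) _ eq ⟩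
      sum (deg G) + sum (λ i → [ a ≐ i ])  ≡⟨ cong (sum (deg G) +_) (sum-[≐] a) ⟩
      sum (deg G) + 1                      ∎)
      where open ≡-Reasoning
    unchanged : ∀ i → i ≢ a → i ≢ b →
                deg G′ i * (n * deg G′ i + toℕ i) ≡ deg G i * (n * deg G i + toℕ i)
    unchanged i i≢a i≢b = cong (λ m → m * (n * m + toℕ i)) (off i i≢a i≢b)
    decrease : deg G′ a * (n * deg G′ a + toℕ a) + deg G′ b * (n * deg G′ b + toℕ b) <
               deg G a * (n * deg G a + toℕ a) + deg G b * (n * deg G b + toℕ b)
    decrease rewrite at-a | at-b = Φ-local (deg G a) (deg G′ b) (toℕ a) (toℕ b)
      (≤-pred (subst (deg G a <_) at-b fa<fb)) (toℕ<n a)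
      (map₂ (≤-pred ∘ subst (suc (deg G a) <_) at-b) a<b⊎)

-- Descent on `Φ`. Keeping the degree sum keeps the number of edges that must go to the deleted
-- pair.
levelling : ∀ (δ : Fin n → ℕ) G → Fits δ G →
  ∃[ G′ ] (Fits δ G′ × sum (deg G′) ≡ sum (deg G) × (∀ a b → ¬ Improvable δ (deg G′) a b))
levelling δ G fits = go G fits (<-wellFounded _)
  where
  go : ∀ G → Fits δ G → Acc _<_ (Φ (deg G)) →
    ∃[ G′ ] (Fits δ G′ × sum (deg G′) ≡ sum (deg G) × (∀ a b → ¬ Improvable δ (deg G′) a b))
  go G fits (acc rec) with any? (λ a → any? (improvable? δ (deg G) a))
  ... | no ¬imp = G , fits , refl , λ a b imp → ¬imp (a , b , imp)
  ... | yes (a , b , imp) =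
    let G₁ , fits₁ , same₁ , lt    = level-step δ G fits imp
        G₂ , fits₂ , same₂ , level = go G₁ fits₁ (rec lt)
    in G₂ , fits₂ , trans same₂ same₁ , level

Nonincr : (Fin n → ℕ) → Set
Nonincr f = ∀ {i j} → toℕ i ≤ toℕ j → f j ≤ f i

-- Suppose `f i < f j` although `i` comes first. Then `i` and `j` are improvable, or `i` has no edge
-- to the pair and `f j ≤ δ j ≤ δ i = f i`, or `j` has two and `2 + f j ≤ δ j ≤ δ i ≤ 2 + f i`.
levelled⇒nonincr : ∀ {δ f : Fin n → ℕ} → Nonincr δ →
  (∀ i → f i ≤ δ i × δ i ≤ 2 + f i) → (∀ a b → ¬ Improvable δ f a b) → Nonincr f
levelled⇒nonincr {δ = δ} {f} δ↘ fits level {i} {j} i≤j with f j ≤? f i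
... | yes fj≤fi = fj≤fi
... | no fj≰fi with f i <? δ i | δ j ≤? suc (f j)
...   | yes p | yes q = contradiction (p , q , ≰⇒> fj≰fi , inj₁ (≤∧≢⇒< i≤j i≢j)) (level i j)
  where
  i≢j : toℕ i ≢ toℕ j
  i≢j eq with refl ← Fin.toℕ-injective eq = fj≰fi ≤-refl
...   | no p  | _     = contradiction (≤-trans (proj₁ (fits j)) (≤-trans (δ↘ i≤j) (≮⇒≥ p))) fj≰fi
...   | _     | no q  = contradiction
  (≤-pred (≤-pred (≤-trans (≰⇒> q) (≤-trans (δ↘ i≤j) (proj₂ (fits i)))))) fj≰fi

-- Parity classes and initial segments.

class : Fin n → Bool
class zero    = true
class (suc i) = not (class i)

DownClosed : (Fin n → Bool) → Set
DownClosed P = ∀ {i j} → toℕ i ≤ toℕ j → P j ≡ true → P i ≡ true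

Balanced : (Fin n → Bool) → Bool → Set
Balanced P b = count (λ i → class i ∧ P i) ≡ count (λ i → not (class i) ∧ P i) + χ b

-- The classes alternate, beginning with the odd one, so its excess toggles between 0 and 1 with
-- each further vertex. Passing to the tail exchanges the classes.
balance : ∀ (P : Fin n → Bool) → DownClosed P → ∃[ b ] Balanced P b
balance {zero}  P down = false , refl
balance {suc n} P down with P zero in P₀
... | false = false , trans (sum-cong-≗ both-0) (sym (+-identityʳ _))
  where
  P-suc : ∀ i → P (suc i) ≡ false
  P-suc i with P (suc i) in eq
  ... | false = refl
  ... | true  = contradiction (trans (sym (down {zero} z≤n eq)) P₀) λ ()
  both-0 : ∀ i → χ (not (class i) ∧ P (suc i)) ≡ χ (not (not (class i)) ∧ P (suc i))
  both-0 i rewrite P-suc i | ∧-zeroʳ (not (class i)) | ∧-zeroʳ (not (not (class i))) = refl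
... | true =
  let b , eq = balance (P ∘ suc) (down ∘ s≤s)
  in not b , tail-eq b eq
  where
  tail-eq : ∀ b → count (λ i → class i ∧ P (suc i)) ≡ count (λ i → not (class i) ∧ P (suc i)) + χ b →
    suc (count (λ i → not (class i) ∧ P (suc i))) ≡
    count (λ i → not (not (class i)) ∧ P (suc i)) + χ (not b)
  tail-eq b eq rewrite sum-cong-≗ {n} (λ i → cong (λ c → χ (c ∧ P (suc i))) (not-involutive (class i))) | eq
    with b
  ... | false = sym (trans (+-comm _ 1) (cong suc (+-identityʳ _)))
  ... | true  = sym (trans (+-identityʳ _) (+-comm _ 1))

balanced-∅ : Balanced {n} (λ _ → false) false
balanced-∅ {n} = trans (sum-cong-≗ {n} λ i → empty (class i)) (sym (+-identityʳ _))
  where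
  empty : ∀ c → χ (c ∧ false) ≡ χ (not c ∧ false)
  empty false = refl
  empty true  = refl

-- The indicator of `A` is that of `Q` plus that of `R` minus that of `P`, so the excess of its odd
-- class is `q + r - p`.
balanced-sum : ∀ (A P Q R : Fin n → Bool) {p q r} →
  (∀ i → χ (A i) + χ (P i) ≡ χ (Q i) + χ (R i)) →
  Balanced P p → Balanced Q q → Balanced R r →
  count (λ i → class i ∧ A i) + χ p ≡ count (λ i → not (class i) ∧ A i) + (χ q + χ r)
balanced-sum A P Q R {p} {q} {r} eq bP bQ bR = +-cancelʳ-≡ P₂ _ _ (begin
  A₁ + χ p + P₂                  ≡⟨ assoc-swap A₁ (χ p) P₂ ⟩
  A₁ + (P₂ + χ p)                ≡⟨ cong (A₁ +_) bP ⟨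
  A₁ + count (λ i → class i ∧ P i)  ≡⟨ restrict class ⟩
  count (λ i → class i ∧ Q i) + count (λ i → class i ∧ R i)  ≡⟨ cong₂ _+_ bQ bR ⟩
  (Q₂ + χ q) + (R₂ + χ r)        ≡⟨ interchange Q₂ (χ q) R₂ (χ r) ⟩
  (Q₂ + R₂) + (χ q + χ r)        ≡⟨ cong (_+ (χ q + χ r)) (restrict (not ∘ class)) ⟨
  (A₂ + P₂) + (χ q + χ r)        ≡⟨ swap-last A₂ P₂ (χ q + χ r) ⟩
  A₂ + (χ q + χ r) + P₂          ∎)
  where
  open ≡-Reasoning
  A₁ = count (λ i → class i ∧ A i)
  A₂ = count (λ i → not (class i) ∧ A i)
  P₂ = count (λ i → not (class i) ∧ P i)
  Q₂ = count (λ i → not (class i) ∧ Q i)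
  R₂ = count (λ i → not (class i) ∧ R i)
  mask : ∀ c i → χ (c ∧ A i) + χ (c ∧ P i) ≡ χ (c ∧ Q i) + χ (c ∧ R i)
  mask false i = refl
  mask true  i = eq i
  restrict : ∀ (c : Fin _ → Bool) →
    count (λ i → c i ∧ A i) + count (λ i → c i ∧ P i) ≡ count (λ i → c i ∧ Q i) + count (λ i → c i ∧ R i)
  restrict c = sum-+-≡ _ (λ i → χ (c i ∧ P i)) _ (λ i → χ (c i ∧ R i)) λ i → mask (c i) i
  assoc-swap : ∀ x y z → x + y + z ≡ x + (z + y)
  assoc-swap = solve-∀
  interchange : ∀ x y z w → (x + y) + (z + w) ≡ (x + z) + (y + w)
  interchange = solve-∀
  swap-last : ∀ x y z → (x + y) + z ≡ x + z + y
  swap-last = solve-∀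

-- Thresholds and the kinds of vertices.

threshold : (Fin n → ℕ) → ℕ → Fin n → Bool
threshold f m i = does (m ≤? f i)

does-true : ∀ {A : Set} (a? : Dec A) → does a? ≡ true → A
does-true (yes a) _ = a

threshold-down : ∀ {f : Fin n → ℕ} → Nonincr f → ∀ m → DownClosed (threshold f m)
threshold-down {f = f} f↘ m {i} {j} i≤j p =
  dec-true (m ≤? f i) (≤-trans (does-true (m ≤? f j) p) (f↘ i≤j))

∧-down : ∀ {P Q : Fin n → Bool} → DownClosed P → DownClosed Q → DownClosed (λ i → P i ∧ Q i)
∧-down {P = P} {Q} P↓ Q↓ {i} {j} i≤j p with P j in Pj | Q j in Qj
∧-down P↓ Q↓ i≤j refl | true | true rewrite P↓ i≤j Pj | Q↓ i≤j Qj = refl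

∨-down : ∀ {P Q : Fin n → Bool} → DownClosed P → DownClosed Q → DownClosed (λ i → P i ∨ Q i)
∨-down {P = P} {Q} P↓ Q↓ {i} {j} i≤j p with P j in Pj | Q j in Qj
∨-down P↓ Q↓ i≤j p | true | _ rewrite P↓ i≤j Pj = refl
∨-down {P = P} P↓ Q↓ {i} i≤j p | false | true rewrite Q↓ i≤j Qj = ∨-zeroʳ (P i)

-- Vertices with a single edge to the deleted pair are split by degree: `E` for `upper`, `E - 1` for
-- `lower`. One of these two numbers is odd.
data Kind : Set where
  none lower upper both : Kind

ρ : Kind → ℕ
ρ none  = 0
ρ lower = 1
ρ upper = 1
ρ both  = 2

isLower isUpper isBoth single : Kind → Bool
isLower lower = true
isLower _     = false
isUpper upper = true
isUpper _     = false
isBoth both = true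
isBoth _    = false
single lower = true
single upper = true
single _     = false

-- Here E = 2 + ℓ, δ is the degree, f the degree after deleting u and w, and ρ k the number of edges
-- into {u, w}.  The conjunction and the disjunction of thresholds cut the blocks δ = E and δ = E - 1
-- where ρ increases, so every threshold set below is an initial segment.
record HasKind (ℓ δ f : ℕ) (k : Kind) : Set where
  field
    total    : δ ≡ f + ρ k
    at-upper : k ≡ upper → δ ≡ 2 + ℓ
    at-lower : k ≡ lower → δ ≡ 1 + ℓ
    upper-eq : χ (isUpper k) + χ (does (3 + ℓ ≤? δ)) ≡ χ (does (2 + ℓ ≤? δ) ∧ does (1 + ℓ ≤? f)) + 0
    lower-eq : χ (isLower k) + χ (does (2 + ℓ ≤? δ) ∨ does (1 + ℓ ≤? f)) ≡ χ (does (1 + ℓ ≤? δ)) + 0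
    both-eq  : χ (isBoth k) + χ (does (2 + ℓ ≤? δ) ∧ does (1 + ℓ ≤? f)) ≡
               χ (does (3 + ℓ ≤? δ)) + χ (does (2 + ℓ ≤? δ))

hasKind : ∀ ℓ δ f → f ≤ δ → δ ≤ 2 + f → (f < δ → ℓ ≤ f) → (δ ≤ 1 + f → f ≤ 1 + ℓ) → ∃[ k ] HasKind ℓ δ f k
hasKind ℓ δ f f≤δ δ≤2+f ≥ℓ ≤1+ℓ = go (δ ∸ f) (sym (m+[n∸m]≡n f≤δ))
  where
  no! : ∀ {m n} → n < m → Reflects (m ≤ n) false
  no! n<m = ofⁿ (<⇒≱ n<m)
  -- Each threshold test is replaced by the truth value that its proof forces, after which the three
  -- equations hold by computation.
  evaluate : ∀ k {p₀ p₂ p₄ q} → δ ≡ f + ρ k → (k ≡ upper → δ ≡ 2 + ℓ) → (k ≡ lower → δ ≡ 1 + ℓ) →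
    Reflects (3 + ℓ ≤ δ) p₀ → Reflects (2 + ℓ ≤ δ) p₂ → Reflects (1 + ℓ ≤ δ) p₄ → Reflects (1 + ℓ ≤ f) q →
    χ (isUpper k) + χ p₀ ≡ χ (p₂ ∧ q) + 0 → χ (isLower k) + χ (p₂ ∨ q) ≡ χ p₄ + 0 →
    χ (isBoth k) + χ (p₂ ∧ q) ≡ χ p₀ + χ p₂ → ∃[ k ] HasKind ℓ δ f k
  evaluate k δ≡ up low r₀ r₂ r₄ r u l b
    with refl ← det r₀ (proof (3 + ℓ ≤? δ)) | refl ← det r₂ (proof (2 + ℓ ≤? δ))
       | refl ← det r₄ (proof (1 + ℓ ≤? δ)) | refl ← det r (proof (1 + ℓ ≤? f)) = k , record
    { total = δ≡ ; at-upper = up ; at-lower = low ; upper-eq = u ; lower-eq = l ; both-eq = b }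
  -- `r` is the number of edges to the deleted pair. For `r = 1` both hypotheses apply and pin `f`
  -- to `ℓ` or `1 + ℓ`; for `r = 0` only the upper bound on `f` is available, for `r = 2` only the
  -- lower one.
  go : ∀ r → δ ≡ f + r → ∃[ k ] HasKind ℓ δ f k
  go 0 δ≡ with refl ← trans δ≡ (+-identityʳ f) | f ≤? ℓ
  ... | yes f≤ℓ = evaluate none δ≡ (λ ()) (λ ())
    (no! (m≤n⇒m≤1+n (m≤n⇒m≤1+n (s≤s f≤ℓ)))) (no! (m≤n⇒m≤1+n (s≤s f≤ℓ)))
    (no! (s≤s f≤ℓ)) (no! (s≤s f≤ℓ)) refl refl refl
  ... | no f≰ℓ = evaluate none δ≡ (λ ()) (λ ())
    (no! (m≤n⇒m≤1+n (s≤s f≤))) (no! (s≤s f≤)) (ofʸ (≰⇒> f≰ℓ)) (ofʸ (≰⇒> f≰ℓ)) refl refl refl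
    where f≤ = ≤1+ℓ (n≤1+n f)
  go 1 δ≡ with refl ← trans δ≡ (+-comm f 1) | f ≤? ℓ
  ... | yes f≤ℓ with refl ← ≤-antisym f≤ℓ (≥ℓ ≤-refl) = evaluate lower δ≡ (λ ()) (λ _ → refl)
    (no! (n≤1+n _)) (no! ≤-refl) (ofʸ ≤-refl) (no! ≤-refl) refl refl refl
  ... | no f≰ℓ with refl ← ≤-antisym (≤1+ℓ ≤-refl) (≰⇒> f≰ℓ) = evaluate upper δ≡ (λ _ → refl) (λ ())
    (no! ≤-refl) (ofʸ ≤-refl) (ofʸ (n≤1+n _)) (ofʸ ≤-refl) refl refl refl
  go 2 δ≡ with refl ← trans δ≡ (+-comm f 2) | f ≤? ℓ
  ... | yes f≤ℓ with refl ← ≤-antisym f≤ℓ (≥ℓ (n≤1+n _)) = evaluate both δ≡ (λ ()) (λ ())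
    (no! ≤-refl) (ofʸ ≤-refl) (ofʸ (n≤1+n _)) (no! ≤-refl) refl refl refl
  ... | no f≰ℓ = evaluate both δ≡ (λ ()) (λ ())
    (ofʸ (s≤s (s≤s ℓ<f))) (ofʸ (s≤s (s≤s (<⇒≤ ℓ<f))))
    (ofʸ (m≤n⇒m≤1+n (s≤s (<⇒≤ ℓ<f)))) (ofʸ ℓ<f) refl refl refl
    where ℓ<f = ≰⇒> f≰ℓ
  go (suc (suc (suc r))) δ≡ = contradiction δ≤2+f
    (<⇒≱ (≤-trans (m≤m+n (3 + f) r) (≤-reflexive (sym (trans δ≡ (shuffle f r))))))
    where
    shuffle : ∀ f r → f + (3 + r) ≡ 3 + f + r
    shuffle = solve-∀

minimal : ∀ {Q : Fin n → Set} → (∀ i → Dec (Q i)) → (f : Fin n → ℕ) →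
  (∀ i → ¬ Q i) ⊎ ∃[ a ] (Q a × (∀ i → Q i → f a ≤ f i))
minimal {zero}  Q? f = inj₁ λ ()
minimal {suc n} Q? f with Q? zero | minimal (Q? ∘ suc) (f ∘ suc)
... | no ¬q | inj₁ ¬Q = inj₁ λ { zero → ¬q ; (suc i) → ¬Q i }
... | no ¬q | inj₂ (a , qa , min) = inj₂ (suc a , qa , λ { zero q → contradiction q ¬q ; (suc i) → min i })
... | yes q | inj₁ ¬Q = inj₂ (zero , q , λ { zero _ → ≤-refl ; (suc i) q → contradiction q (¬Q i) })
... | yes q | inj₂ (a , qa , min) with f zero ≤? f (suc a)
...   | yes ≤a = inj₂ (zero , q , λ { zero _ → ≤-refl ; (suc i) q → ≤-trans ≤a (min i q) })
...   | no ≰a  = inj₂ (suc a , qa , λ { zero _ → <⇒≤ (≰⇒> ≰a) ; (suc i) → min i })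

-- `ℓ` is the least remaining degree of a vertex `a` with an edge to the pair. A vertex with at most
-- one such edge and remaining degree above `1 + ℓ` would be improvable together with `a`.
levelled⇒level : ∀ {δ f : Fin n → ℕ} → (∀ a b → ¬ Improvable δ f a b) →
  ∃[ ℓ ] (∀ i → (f i < δ i → ℓ ≤ f i) × (δ i ≤ 1 + f i → f i ≤ 1 + ℓ))
levelled⇒level {δ = δ} {f} level with minimal (λ i → f i <? δ i) f
-- No edge goes to the pair, so any upper bound of all `f i` serves as the level.
... | inj₁ f≮δ = sum f , λ i → (λ f<δ → contradiction f<δ (f≮δ i)) , λ _ → m≤n⇒m≤1+n (lookup≤sum f i)
... | inj₂ (a , fa<δa , min) = f a , λ i → min i , λ δ≤ → ≮⇒≥ λ f>1+ℓ →
  level a i (fa<δa , δ≤ , <-trans (n<1+n (f a)) f>1+ℓ , inj₂ f>1+ℓ)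

number : (Kind → Bool) → (Fin n → Bool) → (Fin n → Kind) → ℕ
number K s kind = count (λ i → s i ∧ K (kind i))

first second : Fin n → Bool
first  = class
second = not ∘ class

-- With `E = 2 + ℓ`, `profile` takes for the Booleans the excesses of the odd class in the initial
-- segments `δ ≥ E + 1`; `δ ≥ E` and `f ≥ E - 1`; `δ ≥ E`; `δ ≥ E` or `f ≥ E - 1`; `δ ≥ E - 1`, in
-- this order. The summand 0 comes from the empty segment.
record Profile (δ f : Fin n → ℕ) : Set where
  field
    kind     : Fin n → Kind
    ℓ        : ℕ
    total    : ∀ i → δ i ≡ f i + ρ (kind i)
    at-upper : ∀ i → kind i ≡ upper → δ i ≡ 2 + ℓ
    at-lower : ∀ i → kind i ≡ lower → δ i ≡ 1 + ℓ
    b₀ b₁ b₂ b₃ b₄ : Bool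
    upper-diff : number isUpper first kind + χ b₀ ≡ number isUpper second kind + (χ b₁ + 0)
    lower-diff : number isLower first kind + χ b₃ ≡ number isLower second kind + (χ b₄ + 0)
    both-diff  : number isBoth first kind + χ b₁ ≡ number isBoth second kind + (χ b₀ + χ b₂)

profile : ∀ {δ f : Fin n → ℕ} → Nonincr δ → Nonincr f → (∀ i → f i ≤ δ i × δ i ≤ 2 + f i) →
  (∀ a b → ¬ Improvable δ f a b) → Profile δ f
profile {n} {δ} {f} δ↘ f↘ fits level = record
  { kind = proj₁ ∘ kinds ; ℓ = ℓ
  ; total = λ i → HasKind.total (proj₂ (kinds i))
  ; at-upper = λ i → HasKind.at-upper (proj₂ (kinds i))
  ; at-lower = λ i → HasKind.at-lower (proj₂ (kinds i))
  ; upper-diff = balanced-sum (isUpper ∘ proj₁ ∘ kinds) _ _ (λ _ → false)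
      (λ i → HasKind.upper-eq (proj₂ (kinds i))) (proj₂ P₀) (proj₂ P₁) (balanced-∅ {n})
  ; lower-diff = balanced-sum (isLower ∘ proj₁ ∘ kinds) _ _ (λ _ → false)
      (λ i → HasKind.lower-eq (proj₂ (kinds i))) (proj₂ P₃) (proj₂ P₄) (balanced-∅ {n})
  ; both-diff = balanced-sum (isBoth ∘ proj₁ ∘ kinds) _ _ _
      (λ i → HasKind.both-eq (proj₂ (kinds i))) (proj₂ P₁) (proj₂ P₀) (proj₂ P₂)
  }
  where
  ℓ = proj₁ (levelled⇒level level)
  kinds : ∀ i → ∃[ k ] HasKind ℓ (δ i) (f i) k
  kinds i = let f≤ , δ≤ = fits i ; low , high = proj₂ (levelled⇒level level) i
            in hasKind ℓ (δ i) (f i) f≤ δ≤ low high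
  δ≥ : ∀ m → DownClosed (threshold δ m)
  δ≥ = threshold-down δ↘
  f≥ : DownClosed (threshold f (1 + ℓ))
  f≥ = threshold-down f↘ (1 + ℓ)
  P₀ = balance (threshold δ (3 + ℓ)) (δ≥ _)
  P₁ = balance (λ i → threshold δ (2 + ℓ) i ∧ threshold f (1 + ℓ) i) (∧-down (δ≥ _) f≥)
  P₂ = balance (threshold δ (2 + ℓ)) (δ≥ _)
  P₃ = balance (λ i → threshold δ (2 + ℓ) i ∨ threshold f (1 + ℓ) i) (∨-down (δ≥ _) f≥)
  P₄ = balance (threshold δ (1 + ℓ)) (δ≥ _)

-- Class differences and their correction.

data Correction (U₁ U₂ L₁ L₂ : ℕ) : ℕ → ℕ → Set where
  no-flip     : Correction U₁ U₂ L₁ L₂ 0 0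
  flip-first  : 1 ≤ U₁ → 1 ≤ L₁ → Correction U₁ U₂ L₁ L₂ 1 0
  flip-second : 1 ≤ U₂ → 1 ≤ L₂ → Correction U₁ U₂ L₁ L₂ 0 1

data Difference (x y : ℕ) : Set where
  equal : x ≡ y → Difference x y
  more  : x ≡ 1 + y → Difference x y
  fewer : y ≡ 1 + x → Difference x y

more-by-1 : ∀ {x y} → x + 0 ≡ y + 1 → x ≡ 1 + y
more-by-1 {x} {y} eq = trans (sym (+-identityʳ x)) (trans eq (+-comm y 1))

difference : ∀ {x y} b b′ → x + χ b ≡ y + (χ b′ + 0) → Difference x y
difference false false eq = equal (+-cancelʳ-≡ 0 _ _ eq)
difference false true  eq = more (more-by-1 eq)
difference true  false eq = fewer (more-by-1 (sym eq))
difference true  true  eq = equal (+-cancelʳ-≡ 1 _ _ eq)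

-- `b₀` and `b₁` enter the `upper` and the `both` counts with opposite signs, so a surplus in one
-- limits the surplus in the other; hence the joint case distinction.
data UpperDifference (U₁ U₂ B₁ B₂ : ℕ) : Set where
  equal : U₁ ≡ U₂ → B₁ ≤ 1 + B₂ → B₂ ≤ 1 + B₁ → UpperDifference U₁ U₂ B₁ B₂
  more  : U₁ ≡ 1 + U₂ → B₁ ≤ B₂ → B₂ ≤ 1 + B₁ → UpperDifference U₁ U₂ B₁ B₂
  fewer : U₂ ≡ 1 + U₁ → B₁ ≤ 2 + B₂ → B₂ ≤ B₁ → UpperDifference U₁ U₂ B₁ B₂

≤-from-≡ : ∀ {x y} k {p q} → x + p ≡ y + q → q ≤ k + p → x ≤ k + y
≤-from-≡ {x} {y} k {p} {q} eq q≤ = +-cancelʳ-≤ p x (k + y) (begin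
  x + p        ≡⟨ eq ⟩
  y + q        ≤⟨ +-monoʳ-≤ y q≤ ⟩
  y + (k + p)  ≡⟨ rearrange y k p ⟩
  k + y + p    ∎)
  where
  open ≤-Reasoning
  rearrange : ∀ y k p → y + (k + p) ≡ k + y + p
  rearrange = solve-∀

upperDifference : ∀ {U₁ U₂ B₁ B₂} b₀ b₁ b₂ →
  U₁ + χ b₀ ≡ U₂ + (χ b₁ + 0) → B₁ + χ b₁ ≡ B₂ + (χ b₀ + χ b₂) → UpperDifference U₁ U₂ B₁ B₂
upperDifference false false b₂ u b =
  equal (+-cancelʳ-≡ 0 _ _ u) (≤-from-≡ 1 b (χ≤1 b₂)) (≤-from-≡ 1 (sym b) z≤n)
upperDifference true true b₂ u b =
  equal (+-cancelʳ-≡ 1 _ _ u) (≤-from-≡ 1 b (s≤s (χ≤1 b₂))) (≤-from-≡ 1 (sym b) (s≤s z≤n))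
upperDifference false true b₂ u b =
  more (more-by-1 u) (≤-from-≡ 0 b (χ≤1 b₂)) (≤-from-≡ 1 (sym b) (s≤s z≤n))
upperDifference true false b₂ u b =
  fewer (more-by-1 (sym u)) (≤-from-≡ 2 b (s≤s (χ≤1 b₂))) (≤-from-≡ 0 (sym b) z≤n)

-- `F₁` and `F₂` count the single-edge vertices that get a neighbour in their own class. Since the
-- total is even, the differences in `U` and `L` are both zero or both nonzero. Opposite ones
-- cancel; equal ones leave an excess of two, repaired by one flip in the larger class, which then
-- has an `upper` and a `lower` vertex. The final inequalities yield the half-degree bound for the
-- pair.
correction : ∀ {U₁ U₂ L₁ L₂ B₁ B₂} t → UpperDifference U₁ U₂ B₁ B₂ → Difference L₁ L₂ →
  (U₁ + L₁) + (U₂ + L₂) + 2 * (B₁ + B₂) ≡ 2 * t →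
  ∃[ F₁ ] ∃[ F₂ ] (Correction U₁ U₂ L₁ L₂ F₁ F₂ × (U₁ + L₁) + 2 * F₂ ≡ (U₂ + L₂) + 2 * F₁ ×
    B₁ + (F₁ + F₂) ≤ 1 + (B₂ + (U₂ + L₂)) × B₂ + (F₁ + F₂) ≤ 1 + (B₁ + (U₁ + L₁)))
correction {U} {_} {L} {_} {B₁} {B₂} t (equal refl ₁≤₂ ₂≤₁) (equal refl) even =
  0 , 0 , no-flip , refl , widen B₁ B₂ (U + L) ₁≤₂ , widen B₂ B₁ (U + L) ₂≤₁
  where
  widen : ∀ x y z → x ≤ 1 + y → x + 0 ≤ 1 + (y + z)
  widen x y z x≤ = subst (_≤ 1 + (y + z)) (sym (+-identityʳ x)) (≤-trans x≤ (s≤s (m≤m+n y z)))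
correction {U} {_} {_} {L} {B₁} {B₂} t (equal refl _ _) (more refl) even =
  contradiction (trans (sym even) (odd U L B₁ B₂)) (even≢odd t (U + L + B₁ + B₂))
  where
  odd : ∀ U L B₁ B₂ → (U + (1 + L)) + (U + L) + 2 * (B₁ + B₂) ≡ suc (2 * (U + L + B₁ + B₂))
  odd = solve-∀
correction {U} {_} {L} {_} {B₁} {B₂} t (equal refl _ _) (fewer refl) even =
  contradiction (trans (sym even) (odd U L B₁ B₂)) (even≢odd t (U + L + B₁ + B₂))
  where
  odd : ∀ U L B₁ B₂ → (U + L) + (U + (1 + L)) + 2 * (B₁ + B₂) ≡ suc (2 * (U + L + B₁ + B₂))
  odd = solve-∀
correction {_} {U} {L} {_} {B₁} {B₂} t (more refl _ _) (equal refl) even =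
  contradiction (trans (sym even) (odd U L B₁ B₂)) (even≢odd t (U + L + B₁ + B₂))
  where
  odd : ∀ U L B₁ B₂ → (1 + U + L) + (U + L) + 2 * (B₁ + B₂) ≡ suc (2 * (U + L + B₁ + B₂))
  odd = solve-∀
correction {U} {_} {L} {_} {B₁} {B₂} t (fewer refl _ _) (equal refl) even =
  contradiction (trans (sym even) (odd U L B₁ B₂)) (even≢odd t (U + L + B₁ + B₂))
  where
  odd : ∀ U L B₁ B₂ → (U + L) + (1 + U + L) + 2 * (B₁ + B₂) ≡ suc (2 * (U + L + B₁ + B₂))
  odd = solve-∀
correction {_} {U} {_} {L} {B₁} {B₂} t (more refl ₁≤₂ ₂≤₁) (more refl) even =
  1 , 0 , flip-first (s≤s z≤n) (s≤s z≤n) , eq U L , bound₁ , bound₂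
  where
  eq : ∀ U L → 1 + U + (1 + L) + 2 * 0 ≡ U + L + 2 * 1
  eq = solve-∀
  bound₁ : B₁ + 1 ≤ 1 + (B₂ + (U + L))
  bound₁ = ≤-trans (≤-reflexive (+-comm B₁ 1)) (s≤s (≤-trans ₁≤₂ (m≤m+n B₂ _)))
  bound₂ : B₂ + 1 ≤ 1 + (B₁ + (1 + U + (1 + L)))
  bound₂ = ≤-trans (≤-reflexive (+-comm B₂ 1)) (s≤s (≤-trans ₂≤₁
    (≤-trans (m≤m+n (1 + B₁) (U + (1 + L))) (≤-reflexive (sym (+-suc B₁ _))))))
correction {_} {U} {L} {_} {B₁} {B₂} t (more refl ₁≤₂ ₂≤₁) (fewer refl) even =
  0 , 0 , no-flip , eq U L , bound₁ , bound₂
  where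
  eq : ∀ U L → 1 + U + L + 2 * 0 ≡ U + (1 + L) + 2 * 0
  eq = solve-∀
  bound₁ : B₁ + 0 ≤ 1 + (B₂ + (U + (1 + L)))
  bound₁ = ≤-trans (≤-reflexive (+-identityʳ B₁)) (≤-trans ₁≤₂ (m≤n⇒m≤1+n (m≤m+n B₂ _)))
  bound₂ : B₂ + 0 ≤ 1 + (B₁ + (1 + U + L))
  bound₂ = ≤-trans (≤-reflexive (+-identityʳ B₂)) (≤-trans ₂≤₁ (s≤s (m≤m+n B₁ _)))
correction {U} {_} {_} {L} {B₁} {B₂} t (fewer refl ₁≤₂ ₂≤₁) (more refl) even =
  0 , 0 , no-flip , eq U L , bound₁ , bound₂
  where
  eq : ∀ U L → U + (1 + L) + 2 * 0 ≡ 1 + U + L + 2 * 0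
  eq = solve-∀
  bound₁ : B₁ + 0 ≤ 1 + (B₂ + (1 + U + L))
  bound₁ = ≤-trans (≤-reflexive (+-identityʳ B₁)) (≤-trans ₁≤₂
    (s≤s (≤-trans (m≤m+n (1 + B₂) (U + L)) (≤-reflexive (sym (+-suc B₂ _))))))
  bound₂ : B₂ + 0 ≤ 1 + (B₁ + (U + (1 + L)))
  bound₂ = ≤-trans (≤-reflexive (+-identityʳ B₂)) (≤-trans ₂≤₁ (m≤n⇒m≤1+n (m≤m+n B₁ _)))
correction {U} {_} {L} {_} {B₁} {B₂} t (fewer refl ₁≤₂ ₂≤₁) (fewer refl) even =
  0 , 1 , flip-second (s≤s z≤n) (s≤s z≤n) , eq U L , bound₁ , bound₂
  where
  eq : ∀ U L → U + L + 2 * 1 ≡ 1 + U + (1 + L) + 2 * 0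
  eq = solve-∀
  two : ∀ B U L → 2 + B + (U + L) ≡ B + (1 + U + (1 + L))
  two = solve-∀
  bound₁ : B₁ + 1 ≤ 1 + (B₂ + (1 + U + (1 + L)))
  bound₁ = ≤-trans (≤-reflexive (+-comm B₁ 1)) (s≤s (≤-trans ₁≤₂
    (≤-trans (m≤m+n (2 + B₂) (U + L)) (≤-reflexive (two B₂ U L)))))
  bound₂ : B₂ + 1 ≤ 1 + (B₁ + (U + L))
  bound₂ = ≤-trans (≤-reflexive (+-comm B₂ 1)) (s≤s (≤-trans ₂≤₁ (m≤m+n B₁ _)))

-- Degrees of the two members after reattachment.

-- Adjacency between a member of the removed pair and a vertex of kind k; s says whether their
-- classes differ.
joined : Bool → Kind → Bool → Bool
joined s both  fl = true
joined s none  fl = false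
joined s lower fl = s xor fl
joined s upper fl = s xor fl

flipped : (Fin n → Bool) → (Fin n → Kind) → (Fin n → Bool) → ℕ
flipped s kind flip = count (λ i → s i ∧ (flip i ∧ single (kind i)))

-- A member reaches every `both` vertex and the single-edge vertices of the opposite class, loses
-- the flipped ones among these and gains the flipped ones of its own class.
joined-χ : ∀ s k fl → χ (joined s k fl) + χ (s ∧ (fl ∧ single k)) ≡
  χ (s ∧ isBoth k) + χ (not s ∧ isBoth k) + (χ (s ∧ isUpper k) + χ (s ∧ isLower k)) +
  χ (not s ∧ (fl ∧ single k))
joined-χ false none  false = refl
joined-χ false none  true  = refl
joined-χ false lower false = refl
joined-χ false lower true  = refl
joined-χ false upper false = refl
joined-χ false upper true  = refl
joined-χ false both  false = refl
joined-χ false both  true  = refl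
joined-χ true  none  false = refl
joined-χ true  none  true  = refl
joined-χ true  lower false = refl
joined-χ true  lower true  = refl
joined-χ true  upper false = refl
joined-χ true  upper true  = refl
joined-χ true  both  false = refl
joined-χ true  both  true  = refl

joined-across-χ : ∀ s k fl → χ (s ∧ joined s k fl) + χ (s ∧ (fl ∧ single k)) ≡
  χ (s ∧ isBoth k) + (χ (s ∧ isUpper k) + χ (s ∧ isLower k))
joined-across-χ false none  false = refl
joined-across-χ false none  true  = refl
joined-across-χ false lower fl    = refl
joined-across-χ false upper fl    = refl
joined-across-χ false both  fl    = refl
joined-across-χ true  none  false = refl
joined-across-χ true  none  true  = refl
joined-across-χ true  lower false = refl
joined-across-χ true  lower true  = refl
joined-across-χ true  upper false = refl
joined-across-χ true  upper true  = refl
joined-across-χ true  both  false = refl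
joined-across-χ true  both  true  = refl

ρ-χ : ∀ s k → ρ k ≡ (χ (s ∧ isUpper k) + χ (s ∧ isLower k)) +
  (χ (not s ∧ isUpper k) + χ (not s ∧ isLower k)) + 2 * (χ (s ∧ isBoth k) + χ (not s ∧ isBoth k))
ρ-χ false none  = refl
ρ-χ false lower = refl
ρ-χ false upper = refl
ρ-χ false both  = refl
ρ-χ true  none  = refl
ρ-χ true  lower = refl
ρ-χ true  upper = refl
ρ-χ true  both  = refl

sum-eq-+ : ∀ (h f g : Fin n → ℕ) → (∀ i → h i ≡ f i + g i) → sum h ≡ sum f + sum g
sum-eq-+ h f g eq = trans (sum-cong-≗ eq) (∑-distrib-+ f g)

module _ (s s′ : Fin n → Bool) (s′-not : ∀ i → s′ i ≡ not (s i)) (kind : Fin n → Kind) where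
  private
    U U′ L L′ B B′ : ℕ
    U  = number isUpper s kind
    L  = number isLower s kind
    B  = number isBoth s kind
    U′ = number isUpper s′ kind
    L′ = number isLower s′ kind
    B′ = number isBoth s′ kind
    χU χL χB χU′ χL′ χB′ : Fin n → ℕ
    χU  i = χ (s i ∧ isUpper (kind i))
    χL  i = χ (s i ∧ isLower (kind i))
    χB  i = χ (s i ∧ isBoth (kind i))
    χU′ i = χ (s′ i ∧ isUpper (kind i))
    χL′ i = χ (s′ i ∧ isLower (kind i))
    χB′ i = χ (s′ i ∧ isBoth (kind i))

  sum-ρ : sum (ρ ∘ kind) ≡ (U + L) + (U′ + L′) + 2 * (B + B′)
  sum-ρ = trans
    (sum-eq-+ _ (λ i → (χU i + χL i) + (χU′ i + χL′ i)) (λ i → 2 * (χB i + χB′ i)) pointwise)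
    (cong₂ _+_
      (sum-eq-+ _ (λ i → χU i + χL i) (λ i → χU′ i + χL′ i) (λ _ → refl) ⨾
       cong₂ _+_ (∑-distrib-+ χU χL) (∑-distrib-+ χU′ χL′))
      (sym (*-distribˡ-sum 2 (λ i → χB i + χB′ i)) ⨾ cong (2 *_) (∑-distrib-+ χB χB′)))
    where
    _⨾_ = trans
    pointwise : ∀ i → ρ (kind i) ≡ (χU i + χL i) + (χU′ i + χL′ i) + 2 * (χB i + χB′ i)
    pointwise i rewrite s′-not i = ρ-χ (s i) (kind i)

  module _ (flip : Fin n → Bool) where
    private
      N A : Fin n → ℕ
      N i = χ (joined (s i) (kind i) (flip i))
      A i = χ (s i ∧ joined (s i) (kind i) (flip i))
      χF χF′ : Fin n → ℕ
      χF  i = χ (s i ∧ (flip i ∧ single (kind i)))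
      χF′ i = χ (s′ i ∧ (flip i ∧ single (kind i)))

    sum-joined : sum N + flipped s kind flip ≡ (B + B′) + (U + L) + flipped s′ kind flip
    sum-joined = begin
      sum N + sum χF
        ≡⟨ sum-+-≡ N χF (λ i → χB i + χB′ i + (χU i + χL i)) χF′ pointwise ⟩
      sum (λ i → χB i + χB′ i + (χU i + χL i)) + sum χF′
        ≡⟨ cong (_+ sum χF′) (∑-distrib-+ (λ i → χB i + χB′ i) (λ i → χU i + χL i)) ⟩
      sum (λ i → χB i + χB′ i) + sum (λ i → χU i + χL i) + sum χF′
        ≡⟨ cong (_+ sum χF′) (cong₂ _+_ (∑-distrib-+ χB χB′) (∑-distrib-+ χU χL)) ⟩
      (B + B′) + (U + L) + sum χF′  ∎
      where
      open ≡-Reasoning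
      pointwise : ∀ i → N i + χF i ≡ χB i + χB′ i + (χU i + χL i) + χF′ i
      pointwise i rewrite s′-not i = joined-χ (s i) (kind i) (flip i)

    sum-joined-across : sum A + flipped s kind flip ≡ B + (U + L)
    sum-joined-across = trans
      (sum-+-≡ A χF χB (λ i → χU i + χL i) λ i → joined-across-χ (s i) (kind i) (flip i))
      (cong (B +_) (∑-distrib-+ χU χL))

    -- `s` marks the class opposite to the member. The flip balance gives both members the same
    -- number of edges, hence half of `2 * t`. For the bound, `t` is `B + B′ + U + L + F′ - F`,
    -- while `B + U + L - F` edges run across.
    joined-fair : ∀ {t F F′} → flipped s kind flip ≡ F → flipped s′ kind flip ≡ F′ →
      (U + L) + (U′ + L′) + 2 * (B + B′) ≡ 2 * t →
      (U + L) + 2 * F′ ≡ (U′ + L′) + 2 * F →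
      B′ + (F + F′) ≤ 1 + (B + (U + L)) → sum N ≡ t × t ≤ 1 + 2 * sum A
    joined-fair {t} {F} {F′} refl refl total balanced B′≤ = N≡t , t≤
      where
      N≡t : sum N ≡ t
      N≡t = *-cancelˡ-≡ (sum N) t 2 (+-cancelʳ-≡ (2 * F) _ _ (begin
        2 * sum N + 2 * F                      ≡⟨ *-distribˡ-+ 2 (sum N) F ⟨
        2 * (sum N + F)                        ≡⟨ cong (2 *_) sum-joined ⟩
        2 * ((B + B′) + (U + L) + F′)          ≡⟨ expand (B + B′) (U + L) F′ ⟩
        2 * (B + B′) + (U + L) + ((U + L) + 2 * F′)  ≡⟨ cong (2 * (B + B′) + (U + L) +_) balanced ⟩
        2 * (B + B′) + (U + L) + ((U′ + L′) + 2 * F) ≡⟨ regroup (B + B′) (U + L) (U′ + L′) F ⟩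
        (U + L) + (U′ + L′) + 2 * (B + B′) + 2 * F   ≡⟨ cong (_+ 2 * F) total ⟩
        2 * t + 2 * F                          ∎))
        where
        open ≡-Reasoning
        expand : ∀ b o f → 2 * (b + o + f) ≡ 2 * b + o + (o + 2 * f)
        expand = solve-∀
        regroup : ∀ b o o′ f → 2 * b + o + (o′ + 2 * f) ≡ o + o′ + 2 * b + 2 * f
        regroup = solve-∀
      t≤ : t ≤ 1 + 2 * sum A
      t≤ = +-cancelʳ-≤ (2 * F) t _ (begin
        t + 2 * F                                ≡⟨ cong (_+ 2 * F) N≡t ⟨
        sum N + 2 * F                            ≡⟨ split (sum N) F ⟩
        sum N + F + F                            ≡⟨ cong (_+ F) sum-joined ⟩
        (B + B′) + (U + L) + F′ + F              ≡⟨ regroup B B′ (U + L) F F′ ⟩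
        (B + (U + L)) + (B′ + (F + F′))          ≤⟨ +-monoʳ-≤ (B + (U + L)) B′≤ ⟩
        (B + (U + L)) + (1 + (B + (U + L)))      ≡⟨ cong (λ m → m + (1 + m)) sum-joined-across ⟨
        (sum A + F) + (1 + (sum A + F))          ≡⟨ double (sum A) F ⟩
        1 + 2 * sum A + 2 * F                    ∎)
        where
        open ≤-Reasoning
        split : ∀ j f → j + 2 * f ≡ j + f + f
        split = solve-∀
        regroup : ∀ b b′ o f f′ → (b + b′) + o + f′ + f ≡ (b + o) + (b′ + (f + f′))
        regroup = solve-∀
        double : ∀ a f → (a + f) + (1 + (a + f)) ≡ 1 + 2 * a + 2 * f
        double = solve-∀

-- Choosing the vertex to flip.

Odd : ℕ → Set
Odd m = ∃[ k ] m ≡ 1 + 2 * k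

odd-or-odd-suc : ∀ m → Odd m ⊎ Odd (suc m)
odd-or-odd-suc zero = inj₂ (0 , refl)
odd-or-odd-suc (suc m) with odd-or-odd-suc m
... | inj₁ (k , refl) = inj₂ (suc k , cong suc (sym (*-suc 2 k)))
... | inj₂ odd        = inj₁ odd

-- In `fair`, `c` is the class of a member of the pair. Both values occur, because the members are
-- consecutive vertices.
record Assignment (kind : Fin n → Kind) (δ : Fin n → ℕ) (t : ℕ) : Set where
  field
    flip     : Fin n → Bool
    flip-odd : ∀ i → flip i ≡ true → Odd (δ i)
    fair     : ∀ c → let s = λ i → c xor class i in
      count (λ i → joined (s i) (kind i) (flip i)) ≡ t ×
      t ≤ 1 + 2 * count (λ i → s i ∧ joined (s i) (kind i) (flip i))

no-flips : ∀ (s : Fin n → Bool) kind → flipped s kind (λ _ → false) ≡ 0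
no-flips {n} s kind = trans (sum-cong-≗ {n} (λ i → cong χ (∧-zeroʳ (s i)))) (sum-replicate-zero n)

one-flip : ∀ (s : Fin n → Bool) kind y → flipped s kind (λ i → does (y ≟ i)) ≡ χ (s y ∧ single (kind y))
one-flip s kind y = trans
  (sum-cong-≗ λ i → pointwise (s i) (does (y ≟ i)) (single (kind i)))
  (sum-≐ y (λ i → χ (s i ∧ single (kind i))))
  where
  pointwise : ∀ a b c → χ (a ∧ (b ∧ c)) ≡ χ b * χ (a ∧ c)
  pointwise a true  c = sym (*-identityˡ _)
  pointwise a false c = cong χ (∧-zeroʳ a)

isUpper⇒ : ∀ k → isUpper k ≡ true → k ≡ upper
isUpper⇒ upper _ = refl

isLower⇒ : ∀ k → isLower k ≡ true → k ≡ lower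
isLower⇒ lower _ = refl

∧-true : ∀ {a b} → a ∧ b ≡ true → a ≡ true × b ≡ true
∧-true {true} {true} _ = refl , refl

module _ {δ f : Fin n → ℕ} (p : Profile δ f) where
  open Profile p

  -- The degrees of `lower` and `upper` vertices are `1 + ℓ` and `2 + ℓ`; whichever is odd decides
  -- which kind `y` has.
  odd-single : ∀ s → 1 ≤ number isUpper s kind → 1 ≤ number isLower s kind →
    ∃[ y ] (s y ≡ true × single (kind y) ≡ true × Odd (δ y))
  odd-single s 1≤U 1≤L with odd-or-odd-suc (1 + ℓ)
  ... | inj₁ odd =
    let y , eq = count>0⇒∃ (λ i → s i ∧ isLower (kind i)) 1≤L
        sy , ly = ∧-true {s y} eq
        ky = isLower⇒ (kind y) ly
    in y , sy , cong single ky , subst Odd (sym (at-lower y ky)) odd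
  ... | inj₂ odd =
    let y , eq = count>0⇒∃ (λ i → s i ∧ isUpper (kind i)) 1≤U
        sy , uy = ∧-true {s y} eq
        ky = isUpper⇒ (kind y) uy
    in y , sy , cong single ky , subst Odd (sym (at-upper y ky)) odd

  flips : ∀ {F₁ F₂} → Correction (number isUpper first kind) (number isUpper second kind)
                                 (number isLower first kind) (number isLower second kind) F₁ F₂ →
    ∃[ flip ] ((∀ i → flip i ≡ true → Odd (δ i)) ×
      flipped first kind flip ≡ F₁ × flipped second kind flip ≡ F₂)
  flips no-flip = (λ _ → false) , (λ _ ()) , no-flips first kind , no-flips second kind
  flips (flip-first 1≤U 1≤L) =
    let y , sy , ky , odd = odd-single first 1≤U 1≤L
    in (λ i → does (y ≟ i)) , (λ i eq → subst (Odd ∘ δ) (does-true (y ≟ i) eq) odd) ,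
       trans (one-flip first kind y) (cong χ (cong₂ _∧_ sy ky)) ,
       trans (one-flip second kind y) (cong (λ c → χ (not c ∧ single (kind y))) sy)
  flips (flip-second 1≤U 1≤L) =
    let y , sy , ky , odd = odd-single second 1≤U 1≤L
    in (λ i → does (y ≟ i)) , (λ i eq → subst (Odd ∘ δ) (does-true (y ≟ i) eq) odd) ,
       trans (one-flip first kind y) (cong (λ c → χ (c ∧ single (kind y))) (class-false (class y) sy)) ,
       trans (one-flip second kind y) (cong χ (cong₂ _∧_ sy ky))
    where
    class-false : ∀ c → not c ≡ true → c ≡ false
    class-false false _ = refl

  assignment : ∀ t → sum (ρ ∘ kind) ≡ 2 * t → Assignment kind δ t
  assignment t total-2t =
    let total = trans (sym (sum-ρ first second (λ _ → refl) kind)) total-2t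
        F₁ , F₂ , correct , balanced , ≤₁ , ≤₂ =
          correction t (upperDifference b₀ b₁ b₂ upper-diff both-diff) (difference b₃ b₄ lower-diff) total
        flip , odd , eq₁ , eq₂ = flips correct
    in record
      { flip = flip
      ; flip-odd = odd
      ; fair = λ where
          false → joined-fair first second (λ _ → refl) kind flip eq₁ eq₂ total balanced ≤₂
          true  → joined-fair second first (λ i → sym (not-involutive (class i))) kind flip eq₂ eq₁
            (trans (sym (sum-ρ second first (λ i → sym (not-involutive (class i))) kind)) total-2t)
            (sym balanced) (≤-trans (≤-reflexive (cong (number isBoth first kind +_) (+-comm F₂ F₁))) ≤₁)
      }

-- Deleting and re-inserting two consecutive vertices.

skip : Fin (suc n) → Fin n → Fin (2 + n)
skip i y = punchIn (inject₁ i) (punchIn i y)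

class-inject₁ : ∀ (i : Fin n) → class (inject₁ i) ≡ class i
class-inject₁ zero    = refl
class-inject₁ (suc i) = cong not (class-inject₁ i)

-- Vertices before the pair `inject₁ i`, `suc i` keep their index and later ones move by two, so
-- parity is preserved.
class-skip : ∀ (i : Fin (suc n)) y → class (skip i y) ≡ class y
class-skip zero    y       = not-involutive (class y)
class-skip (suc i) zero    = refl
class-skip (suc i) (suc y) = cong not (class-skip i y)

punchIn-inject₁ : ∀ (i : Fin (suc n)) → punchIn (inject₁ i) i ≡ suc i
punchIn-inject₁ zero          = refl
punchIn-inject₁ {suc n} (suc i) = cong suc (punchIn-inject₁ i)

sum-skip : ∀ (i : Fin (suc n)) (f : Fin (2 + n) → ℕ) →
  sum f ≡ f (inject₁ i) + (f (suc i) + sum (f ∘ skip i))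
sum-skip i f = trans (sum-remove {i = inject₁ i} f) (cong (f (inject₁ i) +_)
  (trans (sum-remove {i = i} (f ∘ punchIn (inject₁ i))) (cong (λ j → f j + sum (f ∘ skip i)) (punchIn-inject₁ i))))

-- Names the parts of the decomposition into `inject₁ i`, `suc i` and the range of `skip i`, so that
-- the enlarged adjacency matrix can be given by pattern matching.
data Role (n : ℕ) : Set where
  left right : Role n
  rest       : Fin n → Role n

lift : Role n → Role (suc n)
lift left     = left
lift right    = right
lift (rest y) = rest (suc y)

role : Fin (suc n) → Fin (2 + n) → Role n
role zero zero          = left
role zero (suc zero)    = right
role zero (suc (suc y)) = rest y
role {suc n} (suc i) zero    = rest zero
role {suc n} (suc i) (suc j) = lift (role i j)

role-left : ∀ (i : Fin (suc n)) → role i (inject₁ i) ≡ left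
role-left zero            = refl
role-left {suc n} (suc i) = cong lift (role-left i)

role-right : ∀ (i : Fin (suc n)) → role i (suc i) ≡ right
role-right zero            = refl
role-right {suc n} (suc i) = cong lift (role-right i)

role-rest : ∀ (i : Fin (suc n)) y → role i (skip i y) ≡ rest y
role-rest zero    y       = refl
role-rest (suc i) zero    = refl
role-rest (suc i) (suc y) = cong lift (role-rest i y)

cover : ∀ (i : Fin (suc n)) {P : Fin (2 + n) → Set} →
  P (inject₁ i) → P (suc i) → (∀ y → P (skip i y)) → ∀ j → P j
cover zero l r s zero          = l
cover zero l r s (suc zero)    = r
cover zero l r s (suc (suc y)) = s y
cover {suc n} (suc i) l r s zero    = s zero
cover {suc n} (suc i) {P} l r s (suc j) = cover i {P ∘ suc} l r (s ∘ suc) j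

module Attach (i : Fin (suc n)) (B : Graph n) (own : Bool) (Nₗ Nᵣ : Fin n → Bool) where

  matrix : Role n → Role n → Bool
  matrix left     left     = false
  matrix left     right    = own
  matrix left     (rest y) = Nₗ y
  matrix right    left     = own
  matrix right    right    = false
  matrix right    (rest y) = Nᵣ y
  matrix (rest y) left     = Nₗ y
  matrix (rest y) right    = Nᵣ y
  matrix (rest y) (rest z) = adj B y z

  matrix-sym : ∀ r s → matrix r s ≡ matrix s r
  matrix-sym left     left     = refl
  matrix-sym left     right    = refl
  matrix-sym left     (rest y) = refl
  matrix-sym right    left     = refl
  matrix-sym right    right    = refl
  matrix-sym right    (rest y) = refl
  matrix-sym (rest y) left     = refl
  matrix-sym (rest y) right    = refl
  matrix-sym (rest y) (rest z) = adj-sym B y z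

  matrix-irrefl : ∀ r → matrix r r ≡ false
  matrix-irrefl left     = refl
  matrix-irrefl right    = refl
  matrix-irrefl (rest y) = adj-irrefl B y

  attached : Graph (2 + n)
  attached .adj j k        = matrix (role i j) (role i k)
  attached .adj-sym j k    = matrix-sym (role i j) (role i k)
  attached .adj-irrefl j   = matrix-irrefl (role i j)

  -- The mask `s` lets one formula serve for degrees, with a constant mask, and for degrees into the
  -- opposite class.
  row : ∀ (s : Fin (2 + n) → Bool) {j} r → role i j ≡ r →
    count (λ k → s k ∧ adj attached j k) ≡
    χ (s (inject₁ i) ∧ matrix r left) +
    (χ (s (suc i) ∧ matrix r right) + count (λ y → s (skip i y) ∧ matrix r (rest y)))
  row s {j} _ refl = trans (sum-skip i (λ k → χ (s k ∧ adj attached j k))) (cong₂ _+_ (at (inject₁ i) (role-left i))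
    (cong₂ _+_ (at (suc i) (role-right i)) (sum-cong-≗ λ y → at (skip i y) (role-rest i y))))
    where
    at : ∀ k {q} → role i k ≡ q → χ (s k ∧ adj attached j k) ≡ χ (s k ∧ matrix (role i j) q)
    at k refl = refl

-- The half-degree bound under re-insertion.

opp : Graph n → Fin n → ℕ
opp G v = count (λ j → (class v xor class j) ∧ adj G v j)

-- The required bound with the denominator cleared and no subtraction; `opp` is the degree in the
-- parity bisection.
Good : Graph n → Set
Good G = ∀ v → deg G v ≤ 1 + 2 * opp G v

-- An even number cannot attain the odd bound. The spare unit pays for the neighbour that a flipped
-- vertex gets in its own class.
2k≤1+2a⇒k≤a : ∀ k a → 2 * k ≤ 1 + 2 * a → k ≤ a
2k≤1+2a⇒k≤a k a 2k≤ = ≮⇒≥ λ a<k → <-irrefl refl (begin-strict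
  1 + 2 * a      <⟨ n<1+n _ ⟩
  2 + 2 * a      ≡⟨ *-suc 2 a ⟨
  2 * suc a      ≤⟨ *-monoʳ-≤ 2 a<k ⟩
  2 * k          ≤⟨ 2k≤ ⟩
  1 + 2 * a      ∎)
  where open ≤-Reasoning

joined-total : ∀ s k fl → χ (joined s k fl) + χ (joined (not s) k fl) ≡ ρ k
joined-total false none  false = refl
joined-total false none  true  = refl
joined-total false lower false = refl
joined-total false lower true  = refl
joined-total false upper false = refl
joined-total false upper true  = refl
joined-total false both  fl    = refl
joined-total true  none  false = refl
joined-total true  none  true  = refl
joined-total true  lower false = refl
joined-total true  lower true  = refl
joined-total true  upper false = refl
joined-total true  upper true  = refl
joined-total true  both  fl    = refl

-- A flipped vertex gains a neighbour in its own class; this is harmless because its degree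
-- before the gain is even.
good-extension : ∀ s k fl {f a} → f ≤ 1 + 2 * a → (fl ≡ true → Odd (f + ρ k)) →
  χ (joined s k fl) + (χ (joined (not s) k fl) + f) ≤
  1 + 2 * (χ (s ∧ joined s k fl) + (χ (not s ∧ joined (not s) k fl) + a))
good-extension s k fl {f} {a} f≤ odd = go s k fl odd
  where
  gain₂ : 2 + f ≤ 1 + 2 * (1 + a)
  gain₂ = ≤-trans (s≤s (s≤s f≤)) (≤-reflexive (cong suc (sym (*-suc 2 a))))
  gain₁ : 1 + f ≤ 1 + 2 * (1 + a)
  gain₁ = ≤-trans (n≤1+n _) gain₂
  lose : Odd (f + 1) → 1 + f ≤ 1 + 2 * a
  lose (k , eq) with refl ← suc-injective (trans (+-comm 1 f) eq) = s≤s (*-monoʳ-≤ 2 (2k≤1+2a⇒k≤a k a f≤))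
  go : ∀ s k fl → (fl ≡ true → Odd (f + ρ k)) →
    χ (joined s k fl) + (χ (joined (not s) k fl) + f) ≤
    1 + 2 * (χ (s ∧ joined s k fl) + (χ (not s ∧ joined (not s) k fl) + a))
  go false none  fl    _   = f≤
  go true  none  fl    _   = f≤
  go false both  fl    _   = gain₂
  go true  both  fl    _   = gain₂
  go false lower false _   = gain₁
  go false upper false _   = gain₁
  go true  lower false _   = gain₁
  go true  upper false _   = gain₁
  go false lower true  odd = lose (odd refl)
  go false upper true  odd = lose (odd refl)
  go true  lower true  odd = lose (odd refl)
  go true  upper true  odd = lose (odd refl)

module Reattach (i : Fin (suc n)) (B : Graph n) (good : Good B) (own : Bool) {δ t}
  (kind : Fin n → Kind) (total : ∀ y → δ y ≡ deg B y + ρ (kind y)) (a : Assignment kind δ t) where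
  open Assignment a

  c : Bool
  c = class i

  N : Bool → Fin n → Bool
  N c y = joined (c xor class y) (kind y) (flip y)

  open Attach i B own (N c) (N (not c))

  deg-rest : ∀ y → deg attached (skip i y) ≡ δ y
  deg-rest y = begin
    deg attached (skip i y)                        ≡⟨ row (λ _ → true) (rest y) (role-rest i y) ⟩
    χ (N c y) + (χ (N (not c) y) + deg B y)        ≡⟨ +-assoc (χ (N c y)) _ _ ⟨
    χ (N c y) + χ (N (not c) y) + deg B y          ≡⟨ cong (_+ deg B y) (both-members c (class y)) ⟩
    ρ (kind y) + deg B y                           ≡⟨ +-comm (ρ (kind y)) _ ⟩
    deg B y + ρ (kind y)                           ≡⟨ total y ⟨
    δ y                                            ∎
    where
    open ≡-Reasoning
    both-members : ∀ c d → χ (joined (c xor d) (kind y) (flip y)) +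
                           χ (joined (not c xor d) (kind y) (flip y)) ≡ ρ (kind y)
    both-members false d     = joined-total d (kind y) (flip y)
    both-members true  false = joined-total true (kind y) (flip y)
    both-members true  true  = joined-total false (kind y) (flip y)

  deg-left : deg attached (inject₁ i) ≡ χ own + t
  deg-left = trans (row (λ _ → true) left (role-left i)) (cong (χ own +_) (proj₁ (fair c)))

  deg-right : deg attached (suc i) ≡ χ own + t
  deg-right = trans (row (λ _ → true) right (role-right i)) (cong (χ own +_) (proj₁ (fair (not c))))

  -- Treats both members of the pair. A possible edge between them joins different classes, which
  -- `own≤` expresses; `fair` covers the edges to the rest.
  good-member : ∀ {v} d r → role i v ≡ r → class v ≡ d → deg attached v ≡ χ own + t →
    χ own ≤ χ ((d xor class (inject₁ i)) ∧ matrix r left) + χ ((d xor class (suc i)) ∧ matrix r right) →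
    (∀ y → matrix r (rest y) ≡ N d y) → deg attached v ≤ 1 + 2 * opp attached v
  good-member {v} d r role-v refl deg-v own≤ N-row = begin
    deg attached v           ≡⟨ deg-v ⟩
    χ own + t                ≤⟨ +-mono-≤ own≤ (proj₂ (fair (class v))) ⟩
    -- The bisection degree enters doubled, so the edge within the pair may be counted once more.
    x + y + (1 + 2 * z)      ≤⟨ m≤m+n _ (x + y) ⟩
    x + y + (1 + 2 * z) + (x + y)  ≡⟨ regroup x y z ⟩
    1 + 2 * (x + (y + z))    ≡⟨ cong (λ m → 1 + 2 * (x + (y + m))) (sum-cong-≗ pointwise) ⟩
    1 + 2 * (x + (y + count (λ w → (class v xor class (skip i w)) ∧ matrix r (rest w))))
                             ≡⟨ cong (λ m → 1 + 2 * m) (row (λ k → class v xor class k) r role-v) ⟨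
    1 + 2 * opp attached v   ∎
    where
    open ≤-Reasoning
    x = χ ((class v xor class (inject₁ i)) ∧ matrix r left)
    y = χ ((class v xor class (suc i)) ∧ matrix r right)
    z = count (λ w → (class v xor class w) ∧ N (class v) w)
    regroup : ∀ x y z → x + y + (1 + 2 * z) + (x + y) ≡ 1 + 2 * (x + (y + z))
    regroup = solve-∀
    pointwise : ∀ w → χ ((class v xor class w) ∧ N (class v) w) ≡
                      χ ((class v xor class (skip i w)) ∧ matrix r (rest w))
    pointwise w rewrite class-skip i w | N-row w = refl

  good-attached : Good attached
  good-attached = cover i
    (good-member c left (role-left i) (class-inject₁ i) deg-left own-left (λ _ → refl))
    (good-member (not c) right (role-right i) refl deg-right own-right (λ _ → refl))
    good-rest
    where
    xor-not : ∀ c o → χ o ≤ χ ((c xor not c) ∧ o)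
    xor-not false o = ≤-refl
    xor-not true  o = ≤-refl
    not-xor : ∀ c o → χ o ≤ χ ((not c xor c) ∧ o)
    not-xor false o = ≤-refl
    not-xor true  o = ≤-refl
    own-left : χ own ≤ χ ((c xor class (inject₁ i)) ∧ false) + χ ((c xor not c) ∧ own)
    own-left = ≤-trans (xor-not c own) (m≤n+m _ _)
    own-right : χ own ≤ χ ((not c xor class (inject₁ i)) ∧ own) + χ ((not c xor not c) ∧ false)
    own-right rewrite class-inject₁ i = ≤-trans (not-xor c own) (m≤m+n _ _)
    odd : ∀ {y} → flip y ≡ true → Odd (deg B y + ρ (kind y))
    odd {y} fl = subst Odd (total y) (flip-odd y fl)
    good-rest : ∀ y → deg attached (skip i y) ≤ 1 + 2 * opp attached (skip i y)
    good-rest y = begin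
      deg attached (skip i y)  ≡⟨ row (λ _ → true) (rest y) (role-rest i y) ⟩
      χ (N c y) + (χ (N (not c) y) + deg B y)
        ≤⟨ members c (class y) ⟩
      1 + 2 * (χ ((class y xor c) ∧ N c y) + (χ ((class y xor not c) ∧ N (not c) y) + opp B y))
        ≡⟨ cong (λ m → 1 + 2 * m) opp-eq ⟨
      1 + 2 * opp attached (skip i y)  ∎
      where
      open ≤-Reasoning
      opp-eq : opp attached (skip i y) ≡
        χ ((class y xor c) ∧ N c y) + (χ ((class y xor not c) ∧ N (not c) y) + opp B y)
      opp-eq rewrite row (λ k → class (skip i y) xor class k) (rest y) (role-rest i y)
        | class-skip i y | class-inject₁ i =
        cong (λ m → χ ((class y xor c) ∧ N c y) + (χ ((class y xor not c) ∧ N (not c) y) + m))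
          (sum-cong-≗ λ z → cong (λ d → χ ((class y xor d) ∧ adj B y z)) (class-skip i z))
      -- Only whether the classes agree matters. They are generalized to variables so that the `xor`
      -- terms compute in each case.
      members : ∀ c d → let N′ = λ c → joined (c xor d) (kind y) (flip y) in
        χ (N′ c) + (χ (N′ (not c)) + deg B y) ≤
        1 + 2 * (χ ((d xor c) ∧ N′ c) + (χ ((d xor not c) ∧ N′ (not c)) + opp B y))
      members false false = good-extension false (kind y) (flip y) (good y) odd
      members false true  = good-extension true  (kind y) (flip y) (good y) odd
      members true  false = good-extension true  (kind y) (flip y) (good y) odd
      members true  true  = good-extension false (kind y) (flip y) (good y) odd

-- Two consecutive vertices of equal degree.

strictly-decreasing⇒large : ∀ (f : Fin (suc n) → ℕ) → (∀ i → f (suc i) < f (inject₁ i)) →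
  n + f (fromℕ n) ≤ f zero
strictly-decreasing⇒large {zero}  f f↓ = ≤-refl
strictly-decreasing⇒large {suc n} f f↓ =
  ≤-trans (s≤s (strictly-decreasing⇒large (f ∘ suc) (f↓ ∘ suc))) (f↓ zero)

-- A vertex of degree n + 1 is adjacent to all others, so no vertex is then isolated.
equal-consecutive : ∀ (G : Graph (2 + n)) → Nonincr (deg G) →
  ∃[ i ] deg G (inject₁ i) ≡ deg G (suc i)
equal-consecutive {n} G G↘ with any? (λ i → deg G (inject₁ i) ℕ-≟ deg G (suc i))
... | yes p = p
... | no ¬p = contradiction large (<⇒≱ small)
  where
  last : Fin (2 + n)
  last = suc (fromℕ n)
  is-zero is-last : Fin (2 + n) → ℕ
  is-zero j = [ zero ≐ j ]
  is-last j = [ last ≐ j ]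
  strict : ∀ i → deg G (suc i) < deg G (inject₁ i)
  strict i = ≤∧≢⇒< (G↘ (≤-trans (≤-reflexive (Fin.toℕ-inject₁ i)) (n≤1+n _))) (λ eq → ¬p (i , sym eq))
  large : suc n + deg G last ≤ deg G zero
  large = strictly-decreasing⇒large (deg G) strict
  -- Summed over `j`, this bounds the degree of `zero` by `n` plus the indicator of its edge to
  -- `last`; the degree of `last` counts that edge as well.
  pointwise : ∀ j → χ (adj G zero j) + (is-zero j + is-last j) ≤ 1 + is-last j * χ (adj G zero j)
  pointwise zero rewrite adj-irrefl G zero = ≤-refl
  pointwise (suc j) with fromℕ n ≟ j
  ... | yes _ = ≤-reflexive (trans (+-comm _ 1) (cong suc (sym (*-identityˡ _))))
  ... | no _  = ≤-trans (≤-reflexive (+-identityʳ _)) (χ≤1 (adj G zero (suc j)))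
  total : deg G zero + 2 ≤ (2 + n) + χ (adj G zero last)
  total = begin
    deg G zero + 2
      ≡⟨ cong₂ (λ x y → deg G zero + (x + y)) (sum-[≐] {2 + n} zero) (sum-[≐] last) ⟨
    deg G zero + (sum is-zero + sum is-last)
      ≡⟨ sum-+₂ (χ ∘ adj G zero) is-zero is-last ⟨
    sum (λ j → χ (adj G zero j) + (is-zero j + is-last j))
      ≤⟨ sum-mono-≤ pointwise ⟩
    sum (λ j → 1 + is-last j * χ (adj G zero j))
      ≡⟨ ∑-distrib-+ (λ _ → 1) (λ j → is-last j * χ (adj G zero j)) ⟩
    sum {2 + n} (λ _ → 1) + sum (λ j → is-last j * χ (adj G zero j))
      ≡⟨ cong₂ _+_ (sum-const-1 (2 + n)) (sum-≐ last (χ ∘ adj G zero)) ⟩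
    (2 + n) + χ (adj G zero last)  ∎
    where open ≤-Reasoning
  small : deg G zero < suc n + deg G last
  small = +-cancelʳ-< 1 _ _ (begin-strict
    deg G zero + 1                 <⟨ +-monoʳ-< (deg G zero) (n<1+n 1) ⟩
    deg G zero + 2                 ≤⟨ total ⟩
    (2 + n) + χ (adj G zero last)  ≡⟨ cong (λ b → 2 + n + χ b) (adj-sym G zero last) ⟩
    (2 + n) + χ (adj G last zero)  ≤⟨ +-monoʳ-≤ (2 + n) (lookup≤sum (χ ∘ adj G last) zero) ⟩
    (2 + n) + deg G last           ≡⟨ +-comm 1 (suc n + deg G last) ⟩
    suc n + deg G last + 1         ∎)
    where open ≤-Reasoning

-- Detaching the pair and the induction.

skip-mono : ∀ (i : Fin (suc n)) {y z} → toℕ y ≤ toℕ z → toℕ (skip i y) ≤ toℕ (skip i z)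
skip-mono i {y} {z} y≤z = Fin.punchIn-mono-≤ (inject₁ i) _ _ (Fin.punchIn-mono-≤ i y z y≤z)

module Detach (G : Graph (2 + n)) (i : Fin (suc n)) (equal : deg G (inject₁ i) ≡ deg G (suc i)) where

  own : Bool
  own = adj G (inject₁ i) (suc i)

  B : Graph n
  B .adj y z        = adj G (skip i y) (skip i z)
  B .adj-sym y z    = adj-sym G _ _
  B .adj-irrefl y   = adj-irrefl G _

  δ : Fin n → ℕ
  δ = deg G ∘ skip i

  t : ℕ
  t = count (λ y → adj G (inject₁ i) (skip i y))

  deg-left : deg G (inject₁ i) ≡ χ own + t
  deg-left = trans (sum-skip i (χ ∘ adj G (inject₁ i)))
    (cong (λ b → χ b + (χ own + t)) (adj-irrefl G (inject₁ i)))

  -- The members have equal degrees and share the edge `own`, so they have equally many neighbours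
  -- in the rest.
  t-right : count (λ y → adj G (suc i) (skip i y)) ≡ t
  t-right = +-cancelˡ-≡ (χ own) _ _ (trans (sym deg-right) (trans (sym equal) deg-left))
    where
    deg-right : deg G (suc i) ≡ χ own + count (λ y → adj G (suc i) (skip i y))
    deg-right = trans (sum-skip i (χ ∘ adj G (suc i)))
      (cong₂ _+_ (cong χ (adj-sym G (suc i) (inject₁ i)))
        (cong (λ b → χ b + count (λ y → adj G (suc i) (skip i y))) (adj-irrefl G (suc i))))

  δ-split : ∀ y → δ y ≡ χ (adj G (inject₁ i) (skip i y)) + (χ (adj G (suc i) (skip i y)) + deg B y)
  δ-split y = trans (sum-skip i (χ ∘ adj G (skip i y)))
    (cong₂ _+_ (cong χ (adj-sym G _ _)) (cong (λ b → χ b + deg B y) (adj-sym G _ _)))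

  fits : Fits δ B
  fits y rewrite δ-split y =
    ≤-trans (m≤n+m (deg B y) (χ (adj G (suc i) (skip i y)))) (m≤n+m _ (χ (adj G (inject₁ i) (skip i y)))) ,
    +-mono-≤ (χ≤1 (adj G (inject₁ i) (skip i y))) (+-monoˡ-≤ (deg B y) (χ≤1 (adj G (suc i) (skip i y))))

  sum-δ : sum δ ≡ sum (deg B) + 2 * t
  sum-δ = begin
    sum δ                          ≡⟨ sum-cong-≗ δ-split ⟩
    _                              ≡⟨ sum-+₂ (λ y → χ (adj G (inject₁ i) (skip i y)))
                                              (λ y → χ (adj G (suc i) (skip i y))) (deg B) ⟩
    t + (count (λ y → adj G (suc i) (skip i y)) + sum (deg B))
                                   ≡⟨ cong (λ m → t + (m + sum (deg B))) t-right ⟩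
    t + (t + sum (deg B))          ≡⟨ regroup t (sum (deg B)) ⟩
    sum (deg B) + 2 * t            ∎
    where
    open ≡-Reasoning
    regroup : ∀ t s → t + (t + s) ≡ s + 2 * t
    regroup = solve-∀

-- Induction in steps of two. Of the levelled rest `B₁` only the degrees are carried on: `B₂`
-- realizes them, and `kind` records how many edges each vertex still needs from the pair.
good-realization : ∀ n (G : Graph n) → Nonincr (deg G) → ∃[ G′ ] ((∀ v → deg G′ v ≡ deg G v) × Good G′)
good-realization zero G _ = G , (λ _ → refl) , λ ()
good-realization (suc zero) G _ = G , (λ _ → refl) , λ
  { zero → ≤-trans (≤-reflexive (+-identityʳ _)) (≤-trans (χ≤1 _) (s≤s z≤n)) }
good-realization (suc (suc n)) G G↘ =
  let i , d≡ = equal-consecutive G G↘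
      open Detach G i d≡
      δ↘ : Nonincr δ
      δ↘ = λ y≤z → G↘ (skip-mono i y≤z)
      B₁ , fits₁ , same-sum , level = levelling δ B fits
      B₁↘ : Nonincr (deg B₁)
      B₁↘ = levelled⇒nonincr δ↘ fits₁ level
      B₂ , deg₂ , good₂ = good-realization n B₁ B₁↘
      p = profile δ↘ B₁↘ fits₁ level
      open Profile p
      -- The switchings preserve the degree sum of the rest, so the missing degrees still add up to
      -- the `2 * t` edges removed.
      Σρ : sum (ρ ∘ kind) ≡ 2 * t
      Σρ = +-cancelˡ-≡ (sum (deg B₁)) _ _ (trans (sym (sum-eq-+ δ (deg B₁) (ρ ∘ kind) total))
             (trans sum-δ (cong (_+ 2 * t) (sym same-sum))))
      total₂ : ∀ y → δ y ≡ deg B₂ y + ρ (kind y)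
      total₂ = λ y → trans (total y) (cong (_+ ρ (kind y)) (sym (deg₂ y)))
      open Reattach i B₂ good₂ own kind total₂ (assignment p t Σρ)
        renaming (deg-left to deg-left′; deg-right to deg-right′)
  in Attach.attached i B₂ own (N c) (N (not c)) ,
     cover i (trans deg-left′ (sym deg-left)) (trans deg-right′ (trans (sym deg-left) d≡)) deg-rest ,
     good-attached

-- Translation to the stated definitions.

vec-count : ∀ {A : Set} {P : A → Set} (P? : ∀ x → Dec (P x)) (g : Fin n → A) →
  Vec.count P? (Vec.tabulate g) ≡ count (λ i → does (P? (g i)))
vec-count {zero}  P? g = refl
vec-count {suc n} P? g with does (P? (g zero))
... | true  = cong suc (vec-count P? (g ∘ suc))
... | false = vec-count P? (g ∘ suc)

fromSimple : SimpleGraph n → Graph n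
fromSimple S = record
  { adj        = λ i j → does (adj? i j)
  ; adj-sym    = λ i j → does-⇔ (mk⇔ sym′ sym′) (adj? i j) (adj? j i)
  ; adj-irrefl = λ i → dec-false (adj? i i) (irrefl refl)
  }
  where open SimpleGraph S renaming (sym to sym′)

toSimple : Graph n → SimpleGraph n
toSimple G = record
  { Adj    = λ i j → adj G i j ≡ true
  ; adj?   = λ i j → adj G i j Bool.≟ true
  ; sym    = λ {i} {j} ij → trans (adj-sym G j i) ij
  ; irrefl = λ { refl ij → contradiction (trans (sym ij) (adj-irrefl G _)) λ () }
  }

≟-true : ∀ b → does (b Bool.≟ true) ≡ b
≟-true false = refl
≟-true true  = refl

degree-fromSimple : ∀ (S : SimpleGraph n) v → deg (fromSimple S) v ≡ degree S v
degree-fromSimple S v = sym (vec-count (SimpleGraph.adj? S v) id)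

degree-toSimple : ∀ (G : Graph n) v → degree (toSimple G) v ≡ deg G v
degree-toSimple G v = trans (vec-count (SimpleGraph.adj? (toSimple G) v) id)
  (sum-cong-≗ λ j → cong χ (≟-true (adj G v j)))

parity-label : ∀ (v : Fin n) → ℕ.parity (label v) ≡ (if class v then 1ℙ else 0ℙ)
parity-label zero    = refl
parity-label (suc v) = trans (sym (ℙ.suc-homo-⁻¹ (toℕ v)))
  (trans (cong _⁻¹ (parity-label v)) (opposite (class v)))
  where
  opposite : ∀ c → (if c then 1ℙ else 0ℙ) ⁻¹ ≡ (if not c then 1ℙ else 0ℙ)
  opposite false = refl
  opposite true  = refl

V₁-class : ∀ (v : Fin n) → does (V₁? v) ≡ class v
V₁-class v rewrite parity-label v with class v
... | false = refl
... | true  = refl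

V₂-class : ∀ (v : Fin n) → does (V₂? v) ≡ not (class v)
V₂-class v rewrite parity-label v with class v
... | false = refl
... | true  = refl

degree-bisection : ∀ (G : Graph n) v → degree (parityBisection (toSimple G)) v ≡ opp G v
degree-bisection G v = trans (vec-count (SimpleGraph.adj? (parityBisection (toSimple G)) v) id)
  (sum-cong-≗ λ j → cong χ (across j))
  where
  xor-split : ∀ a b c → a ∧ (b ∧ not c ∨ c ∧ not b) ≡ (b xor c) ∧ a
  xor-split a false false = ∧-zeroʳ a
  xor-split a false true  = ∧-comm a true
  xor-split a true  false = ∧-comm a true
  xor-split a true  true  = ∧-zeroʳ a
  across : ∀ j → does (SimpleGraph.adj? (parityBisection (toSimple G)) v j) ≡
                 (class v xor class j) ∧ adj G v j
  across j rewrite ≟-true (adj G v j) | V₁-class v | V₁-class j | V₂-class v | V₂-class j =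
    xor-split (adj G v j) (class v) (class j)

open import Data.Integer.Base as ℤ using (+_)

-- The subtraction is that of the integers, so for `d = 0` the lower bound is minus one half and not
-- truncated.
half-bound : ∀ {a d} → d ≤ 1 + 2 * a → (+ a) / 1 ≥ (+ d ℤ.- + 1) / 2
half-bound {a} {d} d≤ = *≤* (begin
  (+ d ℤ.- + 1) ℤ.* + 1          ≡⟨ ℤ.*-identityʳ _ ⟩
  + d ℤ.- + 1                    ≤⟨ ℤ.+-monoˡ-≤ (ℤ.- + 1) (ℤ.+≤+ d≤) ⟩
  + (2 * a)                      ≡⟨ cong +_ (*-comm 2 a) ⟩
  + (a * 2)                      ≡⟨ ℤ.pos-* a 2 ⟩
  + a ℤ.* + 2                    ∎)
  where open ℤ.≤-Reasoning

theorem1p1 : (n : ℕ) (d : Vector ℕ n) → Graphic d → Nonincreasing d →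
    ∃[ G ] (HasDegrees G d ×
    (∀ (i : Fin n) →
    (+ degree (parityBisection G) i) / 1 ≥ (+ degree G i ℤ.- + 1) / 2))
theorem1p1 n d (S , S-deg) d↘ =
  let G , deg-G , good = good-realization n (fromSimple S) fromSimple↘
  in toSimple G ,
     (λ i → trans (degree-toSimple G i) (trans (deg-G i) (deg-S i))) ,
     λ i → half-bound (subst₂ (λ d a → d ≤ 1 + 2 * a)
       (sym (degree-toSimple G i)) (sym (degree-bisection G i)) (good i))
  where
  deg-S : ∀ i → deg (fromSimple S) i ≡ d i
  deg-S i = trans (degree-fromSimple S i) (S-deg i)
  fromSimple↘ : Nonincr (deg (fromSimple S))
  fromSimple↘ {i} {j} i≤j = subst₂ _≤_ (sym (deg-S j)) (sym (deg-S i)) (d↘ i j i≤j)
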